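{- Let $K$ be a field and let $f,g\in K[x]$ have degree greater than $1$, with $\mathrm{char}\,K$ dividing neither $\deg f$ nor $\deg g$. If $\mathrm{Prep}(f)\neq\mathrm{Prep}(g)$, then $\langle f,g\rangle$ is a free semigroup on two generators.
   Context: $\mathrm{Prep}(f)$ denotes the set of preperiodic points of $f$ in $\mathbb{P}^1(\overline{K})$ (points with finite forward orbit). $\langle f,g\rangle$ is the semigroup generated by $f,g$ under composition; it is free on two generators if distinct words in $f,g$ give distinct polynomials. -}

module Defs where

open import Level using (Level; _⊔_) renaming (suc to lsuc)
open import Algebra.Bundles using (CommutativeRing)
open import Algebra.Morphism.Structures using (module RingMorphisms)
open import Data.Nat using (ℕ; zero; suc; _<_)
open import Data.Bool using (Bool; true; false)
open import Data.List using (List; []; _∷_; map)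
open import Data.List.NonEmpty using (List⁺; _∷_)
open import Data.Product using (Σ; ∃; _×_; _,_)
open import Data.Sum using (_⊎_)
open import Relation.Nullary using (¬_)
open import Relation.Binary.PropositionalEquality using (_≡_)

record Field (c ℓ : Level) : Set (lsuc (c ⊔ ℓ)) where
  field
    commutativeRing : CommutativeRing c ℓ
  open CommutativeRing commutativeRing public
  field
    1≉0     : ¬ (1# ≈ 0#)
    inverse : ∀ x → ¬ (x ≈ 0#) → Σ Carrier λ y → (x * y) ≈ 1#

-- Polynomials over a commutative ring, as coefficient lists
-- (lowest degree first; trailing zeros allowed).

module Poly {c ℓ : Level} (R : CommutativeRing c ℓ) where
  open CommutativeRing R

  Pol : Set c
  Pol = List Carrier

  coeff : Pol → ℕ → Carrier
  coeff []       _       = 0#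
  coeff (a ∷ p)  zero    = a
  coeff (a ∷ p)  (suc i) = coeff p i

  _≈ₚ_ : Pol → Pol → Set ℓ
  p ≈ₚ q = ∀ i → coeff p i ≈ coeff q i

  HasDegree : Pol → ℕ → Set ℓ
  HasDegree p d = ¬ (coeff p d ≈ 0#) × (∀ i → d < i → coeff p i ≈ 0#)

  _+ₚ_ : Pol → Pol → Pol
  []      +ₚ q       = q
  (a ∷ p) +ₚ []      = a ∷ p
  (a ∷ p) +ₚ (b ∷ q) = (a + b) ∷ (p +ₚ q)

  scale : Carrier → Pol → Pol
  scale a p = map (a *_) p

  _*ₚ_ : Pol → Pol → Pol
  []      *ₚ q = []
  (a ∷ p) *ₚ q = scale a q +ₚ (0# ∷ (p *ₚ q))

  _∘ₚ_ : Pol → Pol → Pol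
  []      ∘ₚ q = []
  (a ∷ p) ∘ₚ q = (a ∷ []) +ₚ (q *ₚ (p ∘ₚ q))

  eval : Pol → Carrier → Carrier
  eval []      x = 0#
  eval (a ∷ p) x = a + (x * eval p x)

  iter : ℕ → (Carrier → Carrier) → Carrier → Carrier
  iter zero    φ x = x
  iter (suc n) φ x = φ (iter n φ x)

  Preperiodic : Pol → Carrier → Set ℓ
  Preperiodic p x = ∃ λ m → ∃ λ n → m < n × iter m (eval p) x ≈ iter n (eval p) x

  _·1 : ℕ → Carrier
  zero  ·1 = 0#
  suc n ·1 = 1# + (n ·1)

  -- elements of the semigroup ⟨f,g⟩: nonempty words in the letters
  -- true (= f) and false (= g); the word b₁ b₂ … bₖ denotes b₁ ∘ b₂ ∘ … ∘ bₖ
  letter : Pol → Pol → Bool → Pol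
  letter f g true  = f
  letter f g false = g

  wordPol′ : Pol → Pol → Bool → List Bool → Pol
  wordPol′ f g b []        = letter f g b
  wordPol′ f g b (b′ ∷ bs) = letter f g b ∘ₚ wordPol′ f g b′ bs

  wordPol : Pol → Pol → List⁺ Bool → Pol
  wordPol f g (b ∷ bs) = wordPol′ f g b bs

  FreeOnTwo : Pol → Pol → Set ℓ
  FreeOnTwo f g = ∀ (u v : List⁺ Bool) → ¬ (u ≡ v) → ¬ (wordPol f g u ≈ₚ wordPol f g v)

record Extension {c ℓ : Level} (K : Field c ℓ) : Set (lsuc (c ⊔ ℓ)) where
  field
    L  : Field c ℓ
    ι  : Field.Carrier K → Field.Carrier L
    isHom : RingMorphisms.IsRingHomomorphism
              (Field.rawRing K) (Field.rawRing L) ι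

-- Prep(f) ≠ Prep(g) (in P¹(K̄)): some point of some extension of K is
-- preperiodic for one of f, g but not for the other.
module _ {c ℓ : Level} (K : Field c ℓ) where
  open Poly (Field.commutativeRing K)

  PrepDiffer : Pol → Pol → Set (lsuc (c ⊔ ℓ))
  PrepDiffer f g =
    Σ (Extension K) λ E →
      let open Extension E
          module PL = Poly (Field.commutativeRing L)
          f′ = map ι f
          g′ = map ι g
      in Σ (Field.Carrier L) λ x →
           (PL.Preperiodic f′ x × ¬ PL.Preperiodic g′ x)
         ⊎ (PL.Preperiodic g′ x × ¬ PL.Preperiodic f′ x)

{-# OPTIONS --safe #-}

-- At infinity a polynomial of degree m is, up to a constant, the m-th power of a Laurent
-- series in 1/x, and we compare the series of two polynomials by the order to which they agree.
-- Composing both with f on the right multiplies this order by deg f.  Given a relation, cancel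
-- common right factors to get u ∘ f = v ∘ g.  Two long words with different last letters can
-- then be compared through the two sides of the relation, so words of length N agree to order
-- 2 ^ N.  Since the degrees are prime to the characteristic, the order of agreement of h ∘ p and
-- h ∘ q is that of p and q (for equal degrees and leading coefficients), and therefore a word is
-- determined by its degree and leading coefficient.
--
-- Let d, e be the degrees and a, b the leading coefficients of f, g.  Comparing leading
-- coefficients in the relation gives a ^ ((e − 1) n) = b ^ ((d − 1) n) for some n > 0, whence
-- f ^ i ∘ g ^ m ∘ f ^ j = f ^ (i + j) ∘ g ^ m for all m, a fixed i and all multiples j of some r.
-- If g ^ m x = g ^ m′ x, then f ^ i ∘ g ^ m and f ^ i ∘ g ^ m′ agree at every f ^ (k r) x, so these
-- points are finite in number and x is preperiodic for f.
module Submission where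

open import Defs
open import Level using (Level; _⊔_)
open import Algebra.Bundles using (CommutativeRing)
open import Algebra.Morphism.Structures using (module RingMorphisms)
import Algebra.Morphism.Construct.Identity as Identity
import Algebra.Properties.CommutativeSemigroup as CommSemigroup
import Algebra.Properties.CommutativeSemiring.Exp as Exp
import Algebra.Properties.Ring as RingProperties
import Algebra.Solver.Ring.NaturalCoefficients.Default as SemiringSolver
import Relation.Binary.Reasoning.Setoid as SetoidReasoning
open import Data.Bool using (Bool; true; false)
open import Data.Empty using (⊥)
open import Data.Fin using (Fin; toℕ; fromℕ<)
open import Data.Fin.Properties using (pigeonhole; toℕ-fromℕ<)
open import Data.List using (List; []; _∷_; map; length; _++_; replicate; reverse)
open import Data.List.NonEmpty using (List⁺; _∷_; toList)
open import Data.List.Properties using (length-++; length-replicate; unfold-reverse; reverse-injective)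
open import Data.Nat as ℕ using (ℕ; zero; suc; _<_; _≤_; z≤n; s≤s; z<s; s<s; NonZero)
import Data.Nat.Properties as ℕ
open import Data.Nat.DivMod using (_%_; _/_; m≡m%n+[m/n]*n; m%n<n)
open import Data.Nat.Divisibility using (_∣_; divides; n∣m*n; ∣m+n∣m⇒∣n; ∣m∣n⇒∣m+n; _∣0; ∣n⇒∣m*n)
open import Data.Nat.Tactic.RingSolver using (solve-∀)
open import Data.Product using (∃; _×_; _,_)
open import Data.Sum using (_⊎_; inj₁; inj₂)
open import Function using (id)
open import Relation.Binary.Definitions using (tri<; tri≈; tri>)
open import Relation.Binary.PropositionalEquality as ≡ using (_≡_; _≢_)
open import Relation.Nullary using (¬_)
open import Relation.Nullary.Negation using (contradiction)

-- Coefficient lists as a commutative ring.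

module PolyRing {c ℓ : Level} (R : CommutativeRing c ℓ) where
  open CommutativeRing R
  open Poly R public
  open RingProperties ring using (-0#≈0#)
  open CommSemigroup +-commutativeSemigroup using (interchange; x∙yz≈y∙xz)

  -- A record, so that the two polynomials can be inferred from the type.
  infix 4 _≋_
  record _≋_ (p q : Pol) : Set ℓ where
    constructor mk≋
    field at : p ≈ₚ q
  open _≋_ public

  negₚ : Pol → Pol
  negₚ = map (-_)

  const : Carrier → Pol
  const a = a ∷ []

  coeff-+ : ∀ p q i → coeff (p +ₚ q) i ≈ coeff p i + coeff q i
  coeff-+ []      q       i       = sym (+-identityˡ _)
  coeff-+ (a ∷ p) []      i       = sym (+-identityʳ _)
  coeff-+ (a ∷ p) (b ∷ q) zero    = refl
  coeff-+ (a ∷ p) (b ∷ q) (suc i) = coeff-+ p q i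

  coeff-scale : ∀ a p i → coeff (scale a p) i ≈ a * coeff p i
  coeff-scale a []      i       = sym (zeroʳ a)
  coeff-scale a (b ∷ p) zero    = refl
  coeff-scale a (b ∷ p) (suc i) = coeff-scale a p i

  coeff-neg : ∀ p i → coeff (negₚ p) i ≈ - coeff p i
  coeff-neg []      i       = sym -0#≈0#
  coeff-neg (b ∷ p) zero    = refl
  coeff-neg (b ∷ p) (suc i) = coeff-neg p i

  coeff-*-zero : ∀ a p q → coeff ((a ∷ p) *ₚ q) 0 ≈ a * coeff q 0
  coeff-*-zero a p q =
    trans (coeff-+ (scale a q) _ 0) (trans (+-identityʳ _) (coeff-scale a q 0))

  coeff-*-suc : ∀ a p q i → coeff ((a ∷ p) *ₚ q) (suc i) ≈ a * coeff q (suc i) + coeff (p *ₚ q) i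
  coeff-*-suc a p q i = trans (coeff-+ (scale a q) _ (suc i)) (+-congʳ (coeff-scale a q (suc i)))

  ≋-refl : ∀ {p} → p ≋ p
  ≋-refl .at i = refl

  ≋-sym : ∀ {p q} → p ≋ q → q ≋ p
  ≋-sym e .at i = sym (at e i)

  ≋-trans : ∀ {p q r} → p ≋ q → q ≋ r → p ≋ r
  ≋-trans e e′ .at i = trans (at e i) (at e′ i)

  ∷-cong : ∀ {a b p q} → a ≈ b → p ≋ q → (a ∷ p) ≋ (b ∷ q)
  ∷-cong a≈b e .at zero    = a≈b
  ∷-cong a≈b e .at (suc i) = at e i

  tail-≋ : ∀ {a b p q} → (a ∷ p) ≋ (b ∷ q) → p ≋ q
  tail-≋ e .at i = at e (suc i)

  tail-≋[] : ∀ {a p} → (a ∷ p) ≋ [] → p ≋ []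
  tail-≋[] e .at i = at e (suc i)

  0∷[]≋[] : (0# ∷ []) ≋ []
  0∷[]≋[] .at zero    = refl
  0∷[]≋[] .at (suc i) = refl

  +ₚ-cong : ∀ {p p′ q q′} → p ≋ p′ → q ≋ q′ → (p +ₚ q) ≋ (p′ +ₚ q′)
  +ₚ-cong {p} {p′} {q} {q′} e e′ .at i =
    trans (coeff-+ p q i) (trans (+-cong (at e i) (at e′ i)) (sym (coeff-+ p′ q′ i)))

  +ₚ-assoc : ∀ p q r → ((p +ₚ q) +ₚ r) ≋ (p +ₚ (q +ₚ r))
  +ₚ-assoc p q r .at i = begin
    coeff ((p +ₚ q) +ₚ r) i                ≈⟨ coeff-+ (p +ₚ q) r i ⟩
    coeff (p +ₚ q) i + coeff r i           ≈⟨ +-congʳ (coeff-+ p q i) ⟩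
    coeff p i + coeff q i + coeff r i      ≈⟨ +-assoc _ _ _ ⟩
    coeff p i + (coeff q i + coeff r i)    ≈⟨ +-congˡ (coeff-+ q r i) ⟨
    coeff p i + coeff (q +ₚ r) i           ≈⟨ coeff-+ p (q +ₚ r) i ⟨
    coeff (p +ₚ (q +ₚ r)) i                ∎
    where open SetoidReasoning setoid

  +ₚ-comm : ∀ p q → (p +ₚ q) ≋ (q +ₚ p)
  +ₚ-comm p q .at i = trans (coeff-+ p q i) (trans (+-comm _ _) (sym (coeff-+ q p i)))

  +ₚ-identityʳ : ∀ p → (p +ₚ []) ≋ p
  +ₚ-identityʳ p .at i = trans (coeff-+ p [] i) (+-identityʳ _)

  negₚ-cong : ∀ {p q} → p ≋ q → negₚ p ≋ negₚ q
  negₚ-cong {p} {q} e .at i = trans (coeff-neg p i) (trans (-‿cong (at e i)) (sym (coeff-neg q i)))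

  negₚ-inverseˡ : ∀ p → (negₚ p +ₚ p) ≋ []
  negₚ-inverseˡ p .at i =
    trans (coeff-+ (negₚ p) p i) (trans (+-congʳ (coeff-neg p i)) (-‿inverseˡ _))

  *ₚ-zeroʳ : ∀ p → (p *ₚ []) ≋ []
  *ₚ-zeroʳ []      = ≋-refl
  *ₚ-zeroʳ (a ∷ p) = ≋-trans (∷-cong refl (*ₚ-zeroʳ p)) 0∷[]≋[]

  -- Trailing zeros let a nonempty list represent zero, so congruence of the product has to treat
  -- this case apart.
  *ₚ-congʳ-[] : ∀ {p} q → p ≋ [] → (p *ₚ q) ≋ []
  *ₚ-congʳ-[] {[]}    q e .at i       = refl
  *ₚ-congʳ-[] {a ∷ p} q e .at zero    =
    trans (coeff-*-zero a p q) (trans (*-congʳ (at e 0)) (zeroˡ _))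
  *ₚ-congʳ-[] {a ∷ p} q e .at (suc i) =
    trans (coeff-*-suc a p q i)
      (trans (+-cong (trans (*-congʳ (at e 0)) (zeroˡ _)) (at (*ₚ-congʳ-[] q (tail-≋[] e)) i))
        (+-identityˡ _))

  *ₚ-cong : ∀ {p p′ q q′} → p ≋ p′ → q ≋ q′ → (p *ₚ q) ≋ (p′ *ₚ q′)
  *ₚ-cong {[]}    {p′}     {q} {q′} e e′ = ≋-sym (*ₚ-congʳ-[] q′ (≋-sym e))
  *ₚ-cong {a ∷ p} {[]}     {q} {q′} e e′ = *ₚ-congʳ-[] q e
  *ₚ-cong {a ∷ p} {b ∷ p′} {q} {q′} e e′ .at zero    =
    trans (coeff-*-zero a p q) (trans (*-cong (at e 0) (at e′ 0)) (sym (coeff-*-zero b p′ q′)))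
  *ₚ-cong {a ∷ p} {b ∷ p′} {q} {q′} e e′ .at (suc i) =
    trans (coeff-*-suc a p q i)
      (trans (+-cong (*-cong (at e 0) (at e′ (suc i))) (at (*ₚ-cong (tail-≋ e) e′) i))
        (sym (coeff-*-suc b p′ q′ i)))

  *ₚ-distribʳ : ∀ r p q → ((p +ₚ q) *ₚ r) ≋ ((p *ₚ r) +ₚ (q *ₚ r))
  *ₚ-distribʳ r []      q       = ≋-refl
  *ₚ-distribʳ r (a ∷ p) []      = ≋-sym (+ₚ-identityʳ _)
  *ₚ-distribʳ r (a ∷ p) (b ∷ q) .at zero = begin
    coeff ((a + b ∷ p +ₚ q) *ₚ r) 0                   ≈⟨ coeff-*-zero (a + b) (p +ₚ q) r ⟩
    (a + b) * coeff r 0                               ≈⟨ distribʳ _ a b ⟩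
    a * coeff r 0 + b * coeff r 0                     ≈⟨ +-cong (coeff-*-zero a p r) (coeff-*-zero b q r) ⟨
    coeff ((a ∷ p) *ₚ r) 0 + coeff ((b ∷ q) *ₚ r) 0   ≈⟨ coeff-+ ((a ∷ p) *ₚ r) ((b ∷ q) *ₚ r) 0 ⟨
    coeff (((a ∷ p) *ₚ r) +ₚ ((b ∷ q) *ₚ r)) 0            ∎
    where open SetoidReasoning setoid
  *ₚ-distribʳ r (a ∷ p) (b ∷ q) .at (suc i) = begin
    coeff ((a + b ∷ p +ₚ q) *ₚ r) (suc i)
      ≈⟨ coeff-*-suc (a + b) (p +ₚ q) r i ⟩
    (a + b) * coeff r (suc i) + coeff ((p +ₚ q) *ₚ r) i
      ≈⟨ +-cong (distribʳ _ a b) (trans (at (*ₚ-distribʳ r p q) i) (coeff-+ (p *ₚ r) (q *ₚ r) i)) ⟩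
    (a * coeff r (suc i) + b * coeff r (suc i)) + (coeff (p *ₚ r) i + coeff (q *ₚ r) i)
      ≈⟨ interchange _ _ _ _ ⟩
    (a * coeff r (suc i) + coeff (p *ₚ r) i) + (b * coeff r (suc i) + coeff (q *ₚ r) i)
      ≈⟨ +-cong (coeff-*-suc a p r i) (coeff-*-suc b q r i) ⟨
    coeff ((a ∷ p) *ₚ r) (suc i) + coeff ((b ∷ q) *ₚ r) (suc i)
      ≈⟨ coeff-+ ((a ∷ p) *ₚ r) ((b ∷ q) *ₚ r) (suc i) ⟨
    coeff (((a ∷ p) *ₚ r) +ₚ ((b ∷ q) *ₚ r)) (suc i) ∎
    where open SetoidReasoning setoid

  -- The defining recursion of the product, moved to its right argument; commutativity then follows
  -- by induction.
  *ₚ-∷ʳ : ∀ p b q → (p *ₚ (b ∷ q)) ≋ (scale b p +ₚ (0# ∷ (p *ₚ q)))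
  *ₚ-∷ʳ []      b q .at zero    = refl
  *ₚ-∷ʳ []      b q .at (suc i) = refl
  *ₚ-∷ʳ (a ∷ p) b q .at zero    = trans (coeff-*-zero a p (b ∷ q))
    (trans (*-comm a b) (sym (+-identityʳ _)))
  *ₚ-∷ʳ (a ∷ p) b q .at (suc i) = begin
    coeff ((a ∷ p) *ₚ (b ∷ q)) (suc i)
      ≈⟨ coeff-*-suc a p (b ∷ q) i ⟩
    a * coeff q i + coeff (p *ₚ (b ∷ q)) i
      ≈⟨ +-cong (sym (coeff-scale a q i)) (trans (at (*ₚ-∷ʳ p b q) i) (coeff-+ (scale b p) (0# ∷ p *ₚ q) i)) ⟩
    coeff (scale a q) i + (coeff (scale b p) i + coeff (0# ∷ p *ₚ q) i)
      ≈⟨ x∙yz≈y∙xz _ _ _ ⟩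
    coeff (scale b p) i + (coeff (scale a q) i + coeff (0# ∷ p *ₚ q) i)
      ≈⟨ +-congˡ (coeff-+ (scale a q) (0# ∷ p *ₚ q) i) ⟨
    coeff (scale b p) i + coeff ((a ∷ p) *ₚ q) i
      ≈⟨ coeff-+ (scale b p) ((a ∷ p) *ₚ q) i ⟨
    coeff (scale b p +ₚ ((a ∷ p) *ₚ q)) i ∎
    where open SetoidReasoning setoid

  *ₚ-comm : ∀ p q → (p *ₚ q) ≋ (q *ₚ p)
  *ₚ-comm []      q = ≋-sym (*ₚ-zeroʳ q)
  *ₚ-comm (a ∷ p) q =
    ≋-trans (+ₚ-cong ≋-refl (∷-cong refl (*ₚ-comm p q))) (≋-sym (*ₚ-∷ʳ q a p))

  scale-*ₚ : ∀ a p q → (scale a p *ₚ q) ≋ scale a (p *ₚ q)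
  scale-*ₚ a []      q = ≋-refl
  scale-*ₚ a (b ∷ p) q .at zero = begin
    coeff (scale a (b ∷ p) *ₚ q) 0  ≈⟨ coeff-*-zero (a * b) (scale a p) q ⟩
    a * b * coeff q 0               ≈⟨ *-assoc a b _ ⟩
    a * (b * coeff q 0)             ≈⟨ *-congˡ (coeff-*-zero b p q) ⟨
    a * coeff ((b ∷ p) *ₚ q) 0      ≈⟨ coeff-scale a ((b ∷ p) *ₚ q) 0 ⟨
    coeff (scale a ((b ∷ p) *ₚ q)) 0 ∎
    where open SetoidReasoning setoid
  scale-*ₚ a (b ∷ p) q .at (suc i) = begin
    coeff (scale a (b ∷ p) *ₚ q) (suc i)
      ≈⟨ coeff-*-suc (a * b) (scale a p) q i ⟩
    a * b * coeff q (suc i) + coeff (scale a p *ₚ q) i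
      ≈⟨ +-cong (*-assoc a b _) (trans (at (scale-*ₚ a p q) i) (coeff-scale a (p *ₚ q) i)) ⟩
    a * (b * coeff q (suc i)) + a * coeff (p *ₚ q) i
      ≈⟨ distribˡ a _ _ ⟨
    a * (b * coeff q (suc i) + coeff (p *ₚ q) i)
      ≈⟨ *-congˡ (coeff-*-suc b p q i) ⟨
    a * coeff ((b ∷ p) *ₚ q) (suc i)
      ≈⟨ coeff-scale a ((b ∷ p) *ₚ q) (suc i) ⟨
    coeff (scale a ((b ∷ p) *ₚ q)) (suc i) ∎
    where open SetoidReasoning setoid

  0∷-*ₚ : ∀ p q → ((0# ∷ p) *ₚ q) ≋ (0# ∷ (p *ₚ q))
  0∷-*ₚ p q .at zero    = trans (coeff-*-zero 0# p q) (zeroˡ _)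
  0∷-*ₚ p q .at (suc i) = trans (coeff-*-suc 0# p q i) (trans (+-congʳ (zeroˡ _)) (+-identityˡ _))

  *ₚ-assoc : ∀ p q r → ((p *ₚ q) *ₚ r) ≋ (p *ₚ (q *ₚ r))
  *ₚ-assoc []      q r = ≋-refl
  *ₚ-assoc (a ∷ p) q r =
    ≋-trans (*ₚ-distribʳ r (scale a q) (0# ∷ p *ₚ q))
      (+ₚ-cong (scale-*ₚ a q r) (≋-trans (0∷-*ₚ (p *ₚ q) r) (∷-cong refl (*ₚ-assoc p q r))))

  const-*ₚ : ∀ a p → (const a *ₚ p) ≋ scale a p
  const-*ₚ a p = ≋-trans (+ₚ-cong ≋-refl 0∷[]≋[]) (+ₚ-identityʳ _)

  *ₚ-identityˡ : ∀ p → (const 1# *ₚ p) ≋ p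
  *ₚ-identityˡ p = ≋-trans (const-*ₚ 1# p) (mk≋ λ i → trans (coeff-scale 1# p i) (*-identityˡ _))

  -- As a bundle, polynomials inherit powers and the semiring solver, and can serve as the target
  -- ring of `Horner`.
  polyRing : CommutativeRing c ℓ
  polyRing = record
    { Carrier = Pol ; _≈_ = _≋_ ; _+_ = _+ₚ_ ; _*_ = _*ₚ_ ; -_ = negₚ ; 0# = [] ; 1# = const 1#
    ; isCommutativeRing = record
      { isRing = record
        { +-isAbelianGroup = record
          { isGroup = record
            { isMonoid = record
              { isSemigroup = record
                { isMagma = record
                  { isEquivalence = record { refl = ≋-refl ; sym = ≋-sym ; trans = ≋-trans }
                  ; ∙-cong = +ₚ-cong }
                ; assoc = +ₚ-assoc }
              ; identity = (λ p → ≋-refl) , +ₚ-identityʳ }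
            ; inverse = negₚ-inverseˡ , λ p → ≋-trans (+ₚ-comm p (negₚ p)) (negₚ-inverseˡ p)
            ; ⁻¹-cong = negₚ-cong }
          ; comm = +ₚ-comm }
        ; *-cong = *ₚ-cong
        ; *-assoc = *ₚ-assoc
        ; *-identity = *ₚ-identityˡ , λ p → ≋-trans (*ₚ-comm p (const 1#)) (*ₚ-identityˡ p)
        ; distrib = (λ r p q → ≋-trans (*ₚ-comm r (p +ₚ q))
                      (≋-trans (*ₚ-distribʳ r p q) (+ₚ-cong (*ₚ-comm p r) (*ₚ-comm q r))))
                  , *ₚ-distribʳ }
      ; *-comm = *ₚ-comm } }

  const-cong : ∀ {a b} → a ≈ b → const a ≋ const b
  const-cong e = ∷-cong e ≋-refl

  const-* : ∀ a b → const (a * b) ≋ (const a *ₚ const b)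
  const-* a b = ≋-sym (const-*ₚ a (const b))

  const-isHom : RingMorphisms.IsRingHomomorphism rawRing (CommutativeRing.rawRing polyRing) const
  const-isHom = record
    { isSemiringHomomorphism = record
      { isNearSemiringHomomorphism = record
        { +-isMonoidHomomorphism = record
          { isMagmaHomomorphism = record
            { isRelHomomorphism = record { cong = const-cong }
            ; homo = λ a b → ≋-refl }
          ; ε-homo = 0∷[]≋[] }
        ; *-homo = const-* }
      ; 1#-homo = ≋-refl }
    ; -‿homo = λ a → ≋-refl }

-- Evaluation at elements of another ring.

-- Evaluation through a ring homomorphism R → S: it specialises to eval ∘ map ι
-- and, for the inclusion of the constants into R[x], to composition.
module Horner {c ℓ c′ ℓ′ : Level} (R : CommutativeRing c ℓ) (S : CommutativeRing c′ ℓ′)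
  (ι : CommutativeRing.Carrier R → CommutativeRing.Carrier S)
  (ι-hom : RingMorphisms.IsRingHomomorphism (CommutativeRing.rawRing R) (CommutativeRing.rawRing S) ι)
  where
  private module R = CommutativeRing R
  open PolyRing R
  open CommutativeRing S
  open RingMorphisms.IsRingHomomorphism ι-hom
  open CommSemigroup +-commutativeSemigroup using (interchange)
  open CommSemigroup *-commutativeSemigroup using (x∙yz≈y∙xz)
  open RingProperties ring using (-‿distribʳ-*; -‿+-comm; -0#≈0#)
  open SetoidReasoning setoid

  horner : Pol → Carrier → Carrier
  horner []      x = 0#
  horner (a ∷ p) x = ι a + x * horner p x

  horner-[] : ∀ {p} x → p ≋ [] → horner p x ≈ 0#
  horner-[] {[]}    x e = refl
  horner-[] {a ∷ p} x e = begin
    ι a + x * horner p x ≈⟨ +-cong (trans (⟦⟧-cong (at e 0)) 0#-homo) (*-congˡ (horner-[] x (tail-≋[] e))) ⟩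
    0# + x * 0#          ≈⟨ +-identityˡ _ ⟩
    x * 0#               ≈⟨ zeroʳ x ⟩
    0#                   ∎

  horner-cong : ∀ {p q x y} → p ≋ q → x ≈ y → horner p x ≈ horner q y
  horner-cong {[]}    {q}     {x} {y} e x≈y = sym (horner-[] y (≋-sym e))
  horner-cong {a ∷ p} {[]}    {x} {y} e x≈y = horner-[] x e
  horner-cong {a ∷ p} {b ∷ q} e x≈y =
    +-cong (⟦⟧-cong (at e 0)) (*-cong x≈y (horner-cong (tail-≋ e) x≈y))

  horner-+ : ∀ p q x → horner (p +ₚ q) x ≈ horner p x + horner q x
  horner-+ []      q       x = sym (+-identityˡ _)
  horner-+ (a ∷ p) []      x = sym (+-identityʳ _)
  horner-+ (a ∷ p) (b ∷ q) x = begin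
    ι (a R.+ b) + x * horner (p +ₚ q) x
      ≈⟨ +-cong (+-homo a b) (trans (*-congˡ (horner-+ p q x)) (distribˡ x _ _)) ⟩
    (ι a + ι b) + (x * horner p x + x * horner q x)
      ≈⟨ interchange _ _ _ _ ⟩
    (ι a + x * horner p x) + (ι b + x * horner q x) ∎

  horner-scale : ∀ a p x → horner (scale a p) x ≈ ι a * horner p x
  horner-scale a []      x = sym (zeroʳ _)
  horner-scale a (b ∷ p) x = begin
    ι (a R.* b) + x * horner (scale a p) x
      ≈⟨ +-cong (*-homo a b) (trans (*-congˡ (horner-scale a p x)) (x∙yz≈y∙xz _ _ _)) ⟩
    ι a * ι b + ι a * (x * horner p x)
      ≈⟨ distribˡ (ι a) _ _ ⟨
    ι a * (ι b + x * horner p x) ∎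

  horner-0∷ : ∀ p x → horner (R.0# ∷ p) x ≈ x * horner p x
  horner-0∷ p x = trans (+-congʳ 0#-homo) (+-identityˡ _)

  horner-* : ∀ p q x → horner (p *ₚ q) x ≈ horner p x * horner q x
  horner-* []      q x = sym (zeroˡ _)
  horner-* (a ∷ p) q x = begin
    horner (scale a q +ₚ (R.0# ∷ p *ₚ q)) x
      ≈⟨ horner-+ (scale a q) (R.0# ∷ p *ₚ q) x ⟩
    horner (scale a q) x + horner (R.0# ∷ p *ₚ q) x
      ≈⟨ +-cong (horner-scale a q x) (horner-0∷ (p *ₚ q) x) ⟩
    ι a * horner q x + x * horner (p *ₚ q) x
      ≈⟨ +-congˡ (trans (*-congˡ (horner-* p q x)) (sym (*-assoc _ _ _))) ⟩
    ι a * horner q x + x * horner p x * horner q x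
      ≈⟨ distribʳ _ _ _ ⟨
    horner (a ∷ p) x * horner q x ∎

  horner-const : ∀ a x → horner (const a) x ≈ ι a
  horner-const a x = trans (+-congˡ (zeroʳ x)) (+-identityʳ _)

  horner-neg : ∀ p x → horner (negₚ p) x ≈ - horner p x
  horner-neg []      x = sym -0#≈0#
  horner-neg (a ∷ p) x = begin
    ι (R.- a) + x * horner (negₚ p) x  ≈⟨ +-cong (-‿homo a) (*-congˡ (horner-neg p x)) ⟩
    - ι a + x * - horner p x           ≈⟨ +-congˡ (-‿distribʳ-* _ _) ⟨
    - ι a + - (x * horner p x)         ≈⟨ -‿+-comm _ _ ⟩
    - (ι a + x * horner p x)           ∎

-- Composition as evaluation in the polynomial ring.

module Composition {c ℓ : Level} (R : CommutativeRing c ℓ) where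
  open CommutativeRing R using (0#; 1#)
  open PolyRing R public
  module P = CommutativeRing polyRing
  open Exp P.commutativeSemiring public using () renaming (_^_ to _^ₚ_)
  private module H = Horner R polyRing const const-isHom
  open SetoidReasoning P.setoid

  ∘ₚ≡horner : ∀ p q → p ∘ₚ q ≡ H.horner p q
  ∘ₚ≡horner []      q = ≡.refl
  ∘ₚ≡horner (a ∷ p) q = ≡.cong (λ r → const a +ₚ (q *ₚ r)) (∘ₚ≡horner p q)

  ∘ₚ-cong : ∀ {p p′ q q′} → p ≋ p′ → q ≋ q′ → (p ∘ₚ q) ≋ (p′ ∘ₚ q′)
  ∘ₚ-cong {p} {p′} {q} {q′} e e′
    rewrite ∘ₚ≡horner p q | ∘ₚ≡horner p′ q′ = H.horner-cong e e′

  ∘ₚ-+ : ∀ p q r → ((p +ₚ q) ∘ₚ r) ≋ ((p ∘ₚ r) +ₚ (q ∘ₚ r))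
  ∘ₚ-+ p q r rewrite ∘ₚ≡horner (p +ₚ q) r | ∘ₚ≡horner p r | ∘ₚ≡horner q r = H.horner-+ p q r

  ∘ₚ-* : ∀ p q r → ((p *ₚ q) ∘ₚ r) ≋ ((p ∘ₚ r) *ₚ (q ∘ₚ r))
  ∘ₚ-* p q r rewrite ∘ₚ≡horner (p *ₚ q) r | ∘ₚ≡horner p r | ∘ₚ≡horner q r = H.horner-* p q r

  ∘ₚ-const : ∀ a r → (const a ∘ₚ r) ≋ const a
  ∘ₚ-const a r rewrite ∘ₚ≡horner (const a) r = H.horner-const a r

  ∘ₚ-^ : ∀ p r s → ((p ^ₚ s) ∘ₚ r) ≋ ((p ∘ₚ r) ^ₚ s)
  ∘ₚ-^ p r zero    = ∘ₚ-const 1# r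
  ∘ₚ-^ p r (suc s) = ≋-trans (∘ₚ-* p (p ^ₚ s) r) (P.*-congˡ {p ∘ₚ r} (∘ₚ-^ p r s))

  ∘ₚ-[] : ∀ {p} r → p ≋ [] → (p ∘ₚ r) ≋ []
  ∘ₚ-[] {p} r e = ∘ₚ-cong {p} {[]} {r} e ≋-refl

  ∘ₚ-assoc : ∀ p q r → ((p ∘ₚ q) ∘ₚ r) ≋ (p ∘ₚ (q ∘ₚ r))
  ∘ₚ-assoc []      q r = ≋-refl
  ∘ₚ-assoc (a ∷ p) q r = begin
    (const a +ₚ (q *ₚ (p ∘ₚ q))) ∘ₚ r           ≈⟨ ∘ₚ-+ (const a) (q *ₚ (p ∘ₚ q)) r ⟩
    (const a ∘ₚ r) +ₚ ((q *ₚ (p ∘ₚ q)) ∘ₚ r)    ≈⟨ P.+-cong (∘ₚ-const a r) (∘ₚ-* q (p ∘ₚ q) r) ⟩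
    const a +ₚ ((q ∘ₚ r) *ₚ ((p ∘ₚ q) ∘ₚ r))    ≈⟨ P.+-congˡ {const a} (P.*-congˡ {q ∘ₚ r} (∘ₚ-assoc p q r)) ⟩
    const a +ₚ ((q ∘ₚ r) *ₚ (p ∘ₚ (q ∘ₚ r)))    ∎

  var : Pol
  var = 0# ∷ 1# ∷ []

  var-*ₚ : ∀ p → (var *ₚ p) ≋ (0# ∷ p)
  var-*ₚ p = ≋-trans (0∷-*ₚ (const 1#) p) (∷-cong (CommutativeRing.refl R) (*ₚ-identityˡ p))

  ∘ₚ-identityʳ : ∀ p → (p ∘ₚ var) ≋ p
  ∘ₚ-identityʳ []      = ≋-refl
  ∘ₚ-identityʳ (a ∷ p) = begin
    const a +ₚ (var *ₚ (p ∘ₚ var))  ≈⟨ P.+-congˡ {const a} (P.*-congˡ {var} (∘ₚ-identityʳ p)) ⟩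
    const a +ₚ (var *ₚ p)           ≈⟨ P.+-congˡ {const a} (var-*ₚ p) ⟩
    const a +ₚ (0# ∷ p)             ≈⟨ ∷-cong (CommutativeRing.+-identityʳ R a) ≋-refl ⟩
    a ∷ p                           ∎

  ∘ₚ-identityˡ : ∀ p → (var ∘ₚ p) ≋ p
  ∘ₚ-identityˡ p = begin
    const 0# +ₚ (p *ₚ (const 1# ∘ₚ p))  ≈⟨ P.+-cong 0∷[]≋[] (P.*-congˡ {p} (∘ₚ-const 1# p)) ⟩
    p *ₚ const 1#                       ≈⟨ P.*-identityʳ p ⟩
    p                                   ∎

-- Degree bounds, leading coefficients and difference quotients.

module Degree {c ℓ : Level} (R : CommutativeRing c ℓ) where
  open CommutativeRing R
  open Composition R
  open RingProperties ring using (-0#≈0#)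
  open Exp commutativeSemiring using (_^_)
  open CommSemigroup *-commutativeSemigroup using (x∙yz≈y∙xz)

  -- p has degree at most m − k, where a negative degree means p = 0.
  record Drop (m k : ℕ) (p : Pol) : Set ℓ where
    constructor mkDrop
    field vanish : ∀ i → m < i ℕ.+ k → coeff p i ≈ 0#
  open Drop public

  -- α may be zero.
  record Lead (m : ℕ) (p : Pol) (α : Carrier) : Set ℓ where
    constructor mkLead
    field
      low : Drop m 0 p
      top : coeff p m ≈ α
  open Lead public

  drop-cong : ∀ {m k p q} → p ≋ q → Drop m k p → Drop m k q
  drop-cong e D .vanish i lt = trans (sym (at e i)) (vanish D i lt)

  drop-[] : ∀ {m k} → Drop m k []
  drop-[] .vanish i _ = refl

  drop-mono : ∀ {m k k′ p} → k′ ≤ k → Drop m k p → Drop m k′ p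
  drop-mono k′≤k D .vanish i lt = vanish D i (ℕ.<-≤-trans lt (ℕ.+-monoʳ-≤ i k′≤k))

  drop-+ : ∀ {m k p q} → Drop m k p → Drop m k q → Drop m k (p +ₚ q)
  drop-+ {p = p} {q} D D′ .vanish i lt =
    trans (coeff-+ p q i) (trans (+-cong (vanish D i lt) (vanish D′ i lt)) (+-identityˡ _))

  drop-neg : ∀ {m k p} → Drop m k p → Drop m k (negₚ p)
  drop-neg {p = p} D .vanish i lt = trans (coeff-neg p i) (trans (-‿cong (vanish D i lt)) -0#≈0#)

  drop-const : ∀ a → Drop 0 0 (const a)
  drop-const a .vanish (suc i) lt = refl

  drop-tail : ∀ {m k a p} → Drop (suc m) k (a ∷ p) → Drop m k p
  drop-tail D .vanish i lt = vanish D (suc i) (s<s lt)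

  drop-tail-[] : ∀ {k a p} → Drop 0 k (a ∷ p) → p ≋ []
  drop-tail-[] D .at i = vanish D (suc i) z<s

  drop-* : ∀ {m k n l} p q → Drop m k p → Drop n l q → Drop (m ℕ.+ n) (k ℕ.+ l) (p *ₚ q)
  drop-* []      q D D′ = drop-[]
  drop-* {m} {k} {n} {l} (a ∷ p) q D D′ = go ≡.refl D
    where
    head-vanishes : ∀ i → m ℕ.+ n < i ℕ.+ (k ℕ.+ l) → a * coeff q i ≈ 0#
    -- If m < k then all of `a ∷ p` vanishes, `a` included; if k ≤ m, the index `i` lies in the
    -- range where `q` vanishes.
    head-vanishes i lt with ℕ.<-≤-connex m k
    ... | inj₁ m<k = trans (*-congʳ (vanish D 0 m<k)) (zeroˡ _)
    ... | inj₂ k≤m = trans (*-congˡ (vanish D′ i (ℕ.+-cancelˡ-< k _ _ lt′))) (zeroʳ _)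
      where
      swap : ∀ i k l → i ℕ.+ (k ℕ.+ l) ≡ k ℕ.+ (i ℕ.+ l)
      swap = solve-∀
      lt′ : k ℕ.+ n < k ℕ.+ (i ℕ.+ l)
      lt′ = ℕ.≤-<-trans (ℕ.+-monoˡ-≤ n k≤m) (≡.subst (m ℕ.+ n <_) (swap i k l) lt)
    -- The bound is split on a copy of `m`, so that `head-vanishes` keeps its type. At bound zero
    -- the tail `p` is zero; at a positive bound it has a smaller one.
    go : ∀ {m′} → m′ ≡ m → Drop m′ k (a ∷ p) → Drop (m ℕ.+ n) (k ℕ.+ l) ((a ∷ p) *ₚ q)
    go _ D″ .vanish zero lt = trans (coeff-*-zero a p q) (head-vanishes 0 lt)
    go {zero} ≡.refl D″ .vanish (suc i) lt =
      trans (coeff-*-suc a p q i)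
        (trans (+-cong (head-vanishes (suc i) lt) (at (*ₚ-congʳ-[] q (drop-tail-[] D″)) i)) (+-identityˡ _))
    go {suc m′} ≡.refl D″ .vanish (suc i) lt =
      trans (coeff-*-suc a p q i)
        (trans (+-cong (head-vanishes (suc i) lt)
                       (vanish (drop-* p q (drop-tail D″) D′) i (ℕ.s<s⁻¹ lt)))
          (+-identityˡ _))

  top-* : ∀ m n p q → Drop m 0 p → Drop n 0 q → coeff (p *ₚ q) (m ℕ.+ n) ≈ coeff p m * coeff q n
  top-* m n [] q D D′ = sym (zeroˡ _)
  top-* zero zero (a ∷ p) q D D′ = coeff-*-zero a p q
  top-* zero (suc n) (a ∷ p) q D D′ =
    trans (coeff-*-suc a p q n)
      (trans (+-congˡ (at (*ₚ-congʳ-[] q (drop-tail-[] D)) n)) (+-identityʳ _))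
  top-* (suc m) n (a ∷ p) q D D′ =
    trans (coeff-*-suc a p q (m ℕ.+ n))
      (trans (+-cong (trans (*-congˡ (vanish D′ (suc (m ℕ.+ n)) lt)) (zeroʳ a))
                     (top-* m n p q (drop-tail D) D′))
        (+-identityˡ _))
    where
    lt : n < suc (m ℕ.+ n) ℕ.+ 0
    lt = ≡.subst (n <_) (≡.sym (ℕ.+-identityʳ _)) (s≤s (ℕ.m≤n+m n m))

  -- A monomial of degree at most m - k becomes a polynomial of degree at most (m - k) d = m d - k
  -- d. This multiplication of the order by `d` is what makes the agreement of words grow
  -- exponentially.
  drop-∘ : ∀ {m k d} p q → Drop m k p → Drop d 0 q → Drop (m ℕ.* d) (k ℕ.* d) (p ∘ₚ q)
  drop-∘ [] q D D′ = drop-[]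
  drop-∘ {m} {k} {d} (a ∷ p) q D D′ = drop-+ {p = const a} head (tail D)
    where
    head : Drop (m ℕ.* d) (k ℕ.* d) (const a)
    head .vanish zero    lt = vanish D 0 (ℕ.*-cancelʳ-< d m k lt)
    head .vanish (suc i) lt = refl
    tail : ∀ {m} → Drop m k (a ∷ p) → Drop (m ℕ.* d) (k ℕ.* d) (q *ₚ (p ∘ₚ q))
    tail {zero}  D″ = drop-cong (≋-sym (≋-trans (P.*-congˡ {q} (∘ₚ-[] {p} q (drop-tail-[] D″))) (P.zeroʳ q))) drop-[]
    tail {suc m} D″ = drop-* q (p ∘ₚ q) D′ (drop-∘ p q (drop-tail D″) D′)

  -- Only the top monomial of `p` reaches degree m d: positivity of `d` keeps the constant terms
  -- split off by the recursion below it.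
  top-∘ : ∀ m d p q → 0 < d → Drop m 0 p → Drop d 0 q →
    coeff (p ∘ₚ q) (m ℕ.* d) ≈ coeff p m * coeff q d ^ m
  top-∘ m       d       []      q _ D D′ = sym (zeroˡ _)
  top-∘ zero    d       (a ∷ p) q _ D D′ =
    trans (coeff-+ (const a) (q *ₚ (p ∘ₚ q)) 0)
      (trans (+-congˡ (at (≋-trans (P.*-congˡ {q} (∘ₚ-[] {p} q (drop-tail-[] D))) (P.zeroʳ q)) 0))
        (trans (+-identityʳ a) (sym (*-identityʳ a))))
  top-∘ (suc m) (suc d) (a ∷ p) q 0<d D D′ =
    trans (coeff-+ (const a) (q *ₚ (p ∘ₚ q)) (suc m ℕ.* suc d))
      (trans (+-identityˡ _)
        (trans (top-* (suc d) (m ℕ.* suc d) q (p ∘ₚ q) D′ (drop-∘ p q (drop-tail D) D′))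
          (trans (*-congˡ (top-∘ m (suc d) p q 0<d (drop-tail D) D′)) (x∙yz≈y∙xz _ _ _))))

  lead-cong : ∀ {m p q α} → p ≋ q → Lead m p α → Lead m q α
  lead-cong e L .low = drop-cong e (low L)
  lead-cong {m} e L .top = trans (sym (at e m)) (top L)

  lead-* : ∀ {m n p q α β} → Lead m p α → Lead n q β → Lead (m ℕ.+ n) (p *ₚ q) (α * β)
  lead-* {p = p} {q} L L′ .low = drop-* p q (low L) (low L′)
  lead-* {m} {n} {p} {q} L L′ .top = trans (top-* m n p q (low L) (low L′)) (*-cong (top L) (top L′))

  lead-const : ∀ a → Lead 0 (const a) a
  lead-const a = mkLead (drop-const a) refl

  lead-+ : ∀ {m p q α β} → Lead m p α → Lead m q β → Lead m (p +ₚ q) (α + β)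
  lead-+ {p = p} {q} L L′ .low = drop-+ {p = p} (low L) (low L′)
  lead-+ {m} {p} {q} L L′ .top = trans (coeff-+ p q m) (+-cong (top L) (top L′))

  lead-^ : ∀ {m p α} s → Lead m p α → Lead (s ℕ.* m) (p ^ₚ s) (α ^ s)
  lead-^ zero    L = lead-const 1#
  lead-^ (suc s) L = lead-* L (lead-^ s L)

  lead-∘ : ∀ {m d p q α β} → 0 < d → Lead m p α → Lead d q β → Lead (m ℕ.* d) (p ∘ₚ q) (α * β ^ m)
  lead-∘ {p = p} {q} 0<d L L′ .low = drop-∘ p q (low L) (low L′)
  lead-∘ {m} {d} {p} {q} 0<d L L′ .top =
    trans (top-∘ m d p q 0<d (low L) (low L′)) (*-cong (top L) (^-congˡ m (top L′)))
    where open Exp commutativeSemiring using (^-congˡ)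

  drop-0⁺ : ∀ {m k i p} → m ≡ i ℕ.+ k → Drop m k p → Drop i 0 p
  drop-0⁺ {k = k} {i} ≡.refl D .vanish j lt =
    vanish D j (ℕ.+-monoˡ-< k (≡.subst (i <_) (ℕ.+-identityʳ j) lt))

  -- Induction on `k`: once `p` is known to have degree at most i = m - k, its coefficient at i
  -- times β is the coefficient of the product at i + n, and that one vanishes. Multiplying by γ,
  -- the inverse of β, finishes.
  drop-*-cancel : ∀ {m n k β γ} p q → Drop m 0 p → Lead n q β → β * γ ≈ 1# →
    Drop (m ℕ.+ n) k (p *ₚ q) → Drop m k p
  drop-*-cancel {k = zero} p q D L βγ D′ = D
  drop-*-cancel {m} {n} {suc k} {β} {γ} p q D L βγ D′ .vanish i lt
    with ℕ.m≤n⇒m<n∨m≡n (ℕ.s≤s⁻¹ (≡.subst (m <_) (ℕ.+-suc i k) lt))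
  ... | inj₁ m<i+k = vanish IH i m<i+k
    where IH = drop-*-cancel {k = k} p q D L βγ (drop-mono (ℕ.n≤1+n k) D′)
  ... | inj₂ m≡i+k = begin
    coeff p i                        ≈⟨ *-identityʳ _ ⟨
    coeff p i * 1#                   ≈⟨ *-congˡ βγ ⟨
    coeff p i * (β * γ)              ≈⟨ *-assoc _ _ _ ⟨
    coeff p i * β * γ                ≈⟨ *-congʳ (*-congˡ (top L)) ⟨
    coeff p i * coeff q n * γ        ≈⟨ *-congʳ (top-* i n p q (drop-0⁺ m≡i+k IH) (low L)) ⟨
    coeff (p *ₚ q) (i ℕ.+ n) * γ     ≈⟨ *-congʳ (vanish D′ (i ℕ.+ n) lt′) ⟩
    0# * γ                           ≈⟨ zeroˡ γ ⟩
    0#                               ∎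
    where
    open SetoidReasoning setoid
    IH = drop-*-cancel {k = k} p q D L βγ (drop-mono (ℕ.n≤1+n k) D′)
    swap : ∀ i n k → i ℕ.+ suc k ℕ.+ n ≡ i ℕ.+ n ℕ.+ suc k
    swap = solve-∀
    lt′ : m ℕ.+ n < i ℕ.+ n ℕ.+ suc k
    lt′ = ≡.subst (m ℕ.+ n <_) (swap i n k) (ℕ.+-monoˡ-< n lt)

  -- The quotient of p(x) − p(y) by x − y.
  diffQuot : Pol → Pol → Pol → Pol
  diffQuot []      x y = []
  diffQuot (a ∷ p) x y = (p ∘ₚ x) +ₚ (y *ₚ diffQuot p x y)

  -- The difference x - y enters as any ε with x = y + ε, which keeps the identity free of
  -- subtraction and open to the semiring solver.
  diffQuot-correct : ∀ p {x y ε} → x ≋ (y +ₚ ε) → (p ∘ₚ x) ≋ ((p ∘ₚ y) +ₚ (ε *ₚ diffQuot p x y))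
  diffQuot-correct []      {x} {y} {ε} e = ≋-sym (P.zeroʳ ε)
  diffQuot-correct (a ∷ p) {x} {y} {ε} e = begin
    const a +ₚ (x *ₚ px)                            ≈⟨ P.+-congˡ {const a} (P.*-congʳ {px} e) ⟩
    const a +ₚ ((y +ₚ ε) *ₚ px)                     ≈⟨ P.+-congˡ {const a} (P.distribʳ px y ε) ⟩
    const a +ₚ ((y *ₚ px) +ₚ (ε *ₚ px))             ≈⟨ P.+-congˡ {const a} (P.+-congʳ {ε *ₚ px} (P.*-congˡ {y} (diffQuot-correct p e))) ⟩
    const a +ₚ ((y *ₚ (py +ₚ (ε *ₚ D))) +ₚ (ε *ₚ px))
      ≈⟨ solve 6 (λ a y py ε D px → a :+ ((y :* (py :+ ε :* D)) :+ ε :* px)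
                     := (a :+ y :* py) :+ ε :* (px :+ y :* D)) ≋-refl (const a) y py ε D px ⟩
    (const a +ₚ (y *ₚ py)) +ₚ (ε *ₚ (px +ₚ (y *ₚ D))) ∎
    where
    open SetoidReasoning P.setoid
    open SemiringSolver P.commutativeSemiring
    px = p ∘ₚ x
    py = p ∘ₚ y
    D  = diffQuot p x y

  diffQuot-[] : ∀ {p} x y → p ≋ [] → diffQuot p x y ≋ []
  diffQuot-[] {[]}    x y e = ≋-refl
  diffQuot-[] {a ∷ p} x y e =
    P.+-cong (∘ₚ-[] {p} x (tail-≋[] e))
      (≋-trans (P.*-congˡ {y} (diffQuot-[] x y (tail-≋[] e))) (P.zeroʳ y))

  -- The quotient of x ^ n - y ^ n by x - y is a sum of n products of n - 1 factors, all with the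
  -- same leading term when x and y have the same one. Hence the factor n = s + 1, as in a
  -- derivative; tameness will make it nonzero.
  lead-diffQuot : ∀ s {p m x y α β} → 0 < m → Lead (suc s) p α → Lead m x β → Lead m y β →
    Lead (s ℕ.* m) (diffQuot p x y) (suc s ·1 * (α * β ^ s))
  lead-diffQuot s {[]} {α = α} 0<m L Lx Ly =
    -- Here α is a coefficient of the empty list, hence zero.
    mkLead drop-[] (sym (trans (*-congˡ (trans (*-congʳ (sym (top L))) (zeroˡ _))) (zeroʳ _)))
  lead-diffQuot zero {a ∷ p} {m} {x} {y} {α} 0<m L Lx Ly =
    lead-cong (≋-sym (≋-trans (P.+-congˡ {p ∘ₚ x} e) (P.+-identityʳ _)))
      (mkLead (low L′) (trans (top L′) (sym (trans (*-congʳ (+-identityʳ 1#)) (*-identityˡ _)))))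
    where
    L′ : Lead 0 (p ∘ₚ x) (α * 1#)
    L′ = lead-∘ 0<m (mkLead (drop-tail (low L)) (top L)) Lx
    -- Constants have difference quotient zero, even when their lists carry trailing zeros.
    p-quot-[] : ∀ p → Drop 0 0 p → diffQuot p x y ≋ []
    p-quot-[] []      D = ≋-refl
    p-quot-[] (b ∷ p) D = P.+-cong (∘ₚ-[] {p} x (drop-tail-[] D))
      (≋-trans (P.*-congˡ {y} (diffQuot-[] x y (drop-tail-[] D))) (P.zeroʳ y))
    e : (y *ₚ diffQuot p x y) ≋ []
    e = ≋-trans (P.*-congˡ {y} (p-quot-[] p (drop-tail (low L)))) (P.zeroʳ y)
  lead-diffQuot (suc s) {a ∷ p} {m} {x} {y} {α} {β} 0<m L Lx Ly =
    mkLead (low L′) (trans (top L′)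
      (solve 4 (λ n α β b → α :* (β :* b) :+ β :* (n :* (α :* b)) := (con 1 :+ n) :* (α :* (β :* b)))
        refl (suc s ·1) α β (β ^ s)))
    where
    open SemiringSolver commutativeSemiring
    L₀ : Lead (suc s) p α
    L₀ = mkLead (drop-tail (low L)) (top L)
    L′ : Lead (suc s ℕ.* m) (diffQuot (a ∷ p) x y) (α * β ^ suc s + β * (suc s ·1 * (α * β ^ s)))
    L′ = lead-+ (lead-∘ 0<m L₀ Lx) (lead-* Ly (lead-diffQuot s 0<m L₀ Lx Ly))

-- Cancellation and comparison of degrees over a field.

module FieldProperties {c ℓ : Level} (K : Field c ℓ) where
  open Field K
  open Composition commutativeRing public
  open Degree commutativeRing public
  open Exp commutativeSemiring using (_^_)
  open SetoidReasoning setoid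

  *-cancelʳ : ∀ {x y z} → ¬ z ≈ 0# → x * z ≈ y * z → x ≈ y
  *-cancelʳ {x} {y} {z} z≉0 e with inverse z z≉0
  ... | w , zw≈1 = begin
    x            ≈⟨ *-identityʳ x ⟨
    x * 1#       ≈⟨ *-congˡ zw≈1 ⟨
    x * (z * w)  ≈⟨ *-assoc x z w ⟨
    x * z * w    ≈⟨ *-congʳ e ⟩
    y * z * w    ≈⟨ *-assoc y z w ⟩
    y * (z * w)  ≈⟨ *-congˡ zw≈1 ⟩
    y * 1#       ≈⟨ *-identityʳ y ⟩
    y            ∎

  *-≉0 : ∀ {x y} → ¬ x ≈ 0# → ¬ y ≈ 0# → ¬ x * y ≈ 0#
  *-≉0 x≉0 y≉0 xy≈0 = x≉0 (*-cancelʳ y≉0 (trans xy≈0 (sym (zeroˡ _))))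

  ^-≉0 : ∀ {x} n → ¬ x ≈ 0# → ¬ x ^ n ≈ 0#
  ^-≉0 zero    x≉0 = 1≉0
  ^-≉0 (suc n) x≉0 = *-≉0 x≉0 (^-≉0 n x≉0)

  ·1-+ : ∀ m n → (m ℕ.+ n) ·1 ≈ m ·1 + n ·1
  ·1-+ zero    n = sym (+-identityˡ _)
  ·1-+ (suc m) n = trans (+-congˡ (·1-+ m n)) (sym (+-assoc _ _ _))

  ·1-* : ∀ m n → (m ℕ.* n) ·1 ≈ m ·1 * n ·1
  ·1-* zero    n = sym (zeroˡ _)
  ·1-* (suc m) n = begin
    (n ℕ.+ m ℕ.* n) ·1         ≈⟨ ·1-+ n (m ℕ.* n) ⟩
    n ·1 + (m ℕ.* n) ·1        ≈⟨ +-cong (sym (*-identityˡ _)) (·1-* m n) ⟩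
    1# * n ·1 + m ·1 * n ·1    ≈⟨ distribʳ _ _ _ ⟨
    (1# + m ·1) * n ·1         ∎

  -- Non-divisibility by the characteristic, phrased without naming the characteristic.
  Tame : ℕ → Set ℓ
  Tame n = ¬ n ·1 ≈ 0#

  tame-* : ∀ {m n} → Tame m → Tame n → Tame (m ℕ.* n)
  tame-* {m} {n} tm tn e = *-≉0 tm tn (trans (sym (·1-* m n)) e)

  lead-≮ : ∀ {m n p q α β} → Lead m p α → Lead n q β → p ≋ q → ¬ β ≈ 0# → ¬ m < n
  lead-≮ {m} {n} Lp Lq e β≉0 m<n = β≉0
    (trans (sym (top Lq)) (trans (sym (at e n)) (vanish (low Lp) n (≡.subst (m <_) (≡.sym (ℕ.+-identityʳ n)) m<n))))

  lead-unique : ∀ {m n p q α β} → Lead m p α → Lead n q β → p ≋ q → ¬ α ≈ 0# → ¬ β ≈ 0# → m ≡ n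
  lead-unique {m} {n} Lp Lq e α≉0 β≉0 with ℕ.<-cmp m n
  ... | tri< m<n _ _ = contradiction m<n (lead-≮ Lp Lq e β≉0)
  ... | tri≈ _ m≡n _ = m≡n
  ... | tri> _ _ n<m = contradiction n<m (lead-≮ Lq Lp (≋-sym e) α≉0)

-- Polynomials over a field have finitely many roots.

module Roots {c ℓ : Level} (K : Field c ℓ) where
  open Field K
  open FieldProperties K
  open RingProperties ring using (x∙y⁻¹≈ε⇒x≈y)
  open CommSemigroup +-commutativeSemigroup using (x∙yz≈y∙xz)
  private
    module H = Horner commutativeRing commutativeRing id (Identity.isRingHomomorphism rawRing refl)

    eval≡horner : ∀ p x → eval p x ≡ H.horner p x
    eval≡horner []      x = ≡.refl
    eval≡horner (a ∷ p) x = ≡.cong (λ y → a + x * y) (eval≡horner p x)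

  eval-+ : ∀ p q x → eval (p +ₚ q) x ≈ eval p x + eval q x
  eval-+ p q x rewrite eval≡horner (p +ₚ q) x | eval≡horner p x | eval≡horner q x = H.horner-+ p q x

  eval-scale : ∀ a p x → eval (scale a p) x ≈ a * eval p x
  eval-scale a p x rewrite eval≡horner (scale a p) x | eval≡horner p x = H.horner-scale a p x

  eval-[] : ∀ {p} x → p ≋ [] → eval p x ≈ 0#
  eval-[] {p} x e rewrite eval≡horner p x = H.horner-[] x e

  -- The quotient in the division of p by x − r.
  quot : Carrier → Pol → Pol
  quot r []      = []
  quot r (a ∷ p) = p +ₚ scale r (quot r p)

  eval-quot : ∀ p {r x ε} → x ≈ r + ε → eval p x ≈ eval p r + ε * eval (quot r p) x
  eval-quot []      {r} {x} {ε} e = sym (trans (+-identityˡ _) (zeroʳ ε))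
  eval-quot (a ∷ p) {r} {x} {ε} e = begin
    a + x * px                             ≈⟨ +-congˡ (*-congʳ e) ⟩
    a + (r + ε) * px                       ≈⟨ +-congˡ (distribʳ px r ε) ⟩
    a + (r * px + ε * px)                  ≈⟨ +-congˡ (+-congʳ (*-congˡ (eval-quot p e))) ⟩
    a + (r * (pr + ε * qx) + ε * px)
      ≈⟨ solve 6 (λ a r pr ε qx px → a :+ (r :* (pr :+ ε :* qx) :+ ε :* px)
                     := a :+ r :* pr :+ ε :* (px :+ r :* qx)) refl a r pr ε qx px ⟩
    a + r * pr + ε * (px + r * qx)         ≈⟨ +-congˡ (*-congˡ (+-congˡ (eval-scale r (quot r p) x))) ⟨
    a + r * pr + ε * (px + eval (scale r (quot r p)) x)
                                           ≈⟨ +-congˡ (*-congˡ (eval-+ p (scale r (quot r p)) x)) ⟨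
    a + r * pr + ε * eval (p +ₚ scale r (quot r p)) x ∎
    where
    open SetoidReasoning setoid
    open SemiringSolver commutativeSemiring
    px = eval p x
    pr = eval p r
    qx = eval (quot r p) x

  scale-[] : ∀ r {p} → p ≋ [] → scale r p ≋ []
  scale-[] r {p} e .at i = trans (coeff-scale r p i) (trans (*-congˡ (at e i)) (zeroʳ r))

  drop-scale : ∀ r {m k p} → Drop m k p → Drop m k (scale r p)
  drop-scale r {p = p} D .vanish i lt = trans (coeff-scale r p i) (trans (*-congˡ (vanish D i lt)) (zeroʳ r))

  quot-[] : ∀ r {p} → p ≋ [] → quot r p ≋ []
  quot-[] r {[]}    e = ≋-refl
  quot-[] r {a ∷ p} e = P.+-cong {p} (tail-≋[] e) (scale-[] r (quot-[] r (tail-≋[] e)))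

  drop-quot : ∀ r {n} p → Drop (suc n) 0 p → Drop n 0 (quot r p)
  drop-quot r         []      D = drop-[]
  drop-quot r {suc n} (a ∷ p) D = drop-+ {p = p} (drop-tail D) (drop-scale r rec)
    where
    rec : Drop (suc n) 0 (quot r p)
    rec .vanish i lt = vanish (drop-quot r p (drop-tail D)) i (ℕ.<-trans ℕ.≤-refl lt)
  drop-quot r {zero}  (a ∷ p) D = drop-+ {p = p} (drop-tail D) (drop-scale r (const-quot p (drop-tail D)))
    where
    const-quot : ∀ p → Drop 0 0 p → Drop 0 0 (quot r p)
    const-quot []      D = drop-[]
    const-quot (b ∷ p) D = drop-cong
      (≋-sym (P.+-cong {p} (drop-tail-[] D) (scale-[] r (quot-[] r (drop-tail-[] D))))) drop-[]

  top-quot : ∀ r n p → Drop (suc n) 0 p → coeff (quot r p) n ≈ coeff p (suc n)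
  top-quot r n []      D = refl
  top-quot r n (a ∷ p) D =
    trans (coeff-+ p (scale r (quot r p)) n)
      (trans (+-congˡ (trans (coeff-scale r (quot r p) n) (trans (*-congˡ (rest n p (drop-tail D))) (zeroʳ r))))
        (+-identityʳ _))
    where
    rest : ∀ n p → Drop n 0 p → coeff (quot r p) n ≈ 0#
    rest zero    []      D = refl
    rest zero    (b ∷ p) D = at (P.+-cong {p} (drop-tail-[] D) (scale-[] r (quot-[] r (drop-tail-[] D)))) 0
    rest (suc n) p       D = vanish (drop-quot r p D) (suc n) (s≤s (ℕ.m≤m+n n 0))

  lead-quot : ∀ r {n p α} → Lead (suc n) p α → Lead n (quot r p) α
  lead-quot r {n} {p} L = mkLead (drop-quot r p (low L)) (trans (top-quot r n p (low L)) (top L))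

  -- Dividing by x - `y 0` lowers the degree and leaves a polynomial that vanishes on the rest of
  -- the sequence, down to a nonzero constant with a root. A sequence of distinct roots, rather than
  -- a count of roots, avoids deciding equality in the field.
  finitely-many-roots : ∀ n {p α} → Lead n p α → ¬ α ≈ 0# → (y : ℕ → Carrier) →
    (∀ i → eval p (y i) ≈ 0#) → (∀ {i j} → i < j → ¬ y i ≈ y j) → ⊥
  finitely-many-roots zero {[]} L α≉0 y root distinct = α≉0 (sym (top L))
  finitely-many-roots zero {a ∷ p} {α} L α≉0 y root distinct = α≉0 (begin
    α                           ≈⟨ top L ⟨
    a                           ≈⟨ +-identityʳ a ⟨
    a + 0#                      ≈⟨ +-congˡ (zeroʳ (y 0)) ⟨
    a + y 0 * 0#                ≈⟨ +-congˡ (*-congˡ (eval-[] (y 0) (drop-tail-[] (low L)))) ⟨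
    a + y 0 * eval p (y 0)      ≈⟨ root 0 ⟩
    0#                          ∎)
    where open SetoidReasoning setoid
  finitely-many-roots (suc n) {p} L α≉0 y root distinct =
    finitely-many-roots n (lead-quot (y 0) L) α≉0 (λ i → y (suc i)) root′ (λ i<j → distinct (s<s i<j))
    where
    root′ : ∀ i → eval (quot (y 0) p) (y (suc i)) ≈ 0#
    root′ i = *-cancelʳ {z = ε} ε≉0 (begin
      Q * ε                     ≈⟨ *-comm Q ε ⟩
      ε * Q                     ≈⟨ +-identityˡ _ ⟨
      0# + ε * Q                ≈⟨ +-congʳ (root 0) ⟨
      eval p (y 0) + ε * Q      ≈⟨ eval-quot p split ⟨
      eval p (y (suc i))        ≈⟨ root (suc i) ⟩
      0#                        ≈⟨ zeroˡ ε ⟨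
      0# * ε                    ∎)
      where
      open SetoidReasoning setoid
      Q = eval (quot (y 0) p) (y (suc i))
      ε = y (suc i) - y 0
      ε≉0 : ¬ ε ≈ 0#
      ε≉0 e = distinct {0} {suc i} z<s (sym (x∙y⁻¹≈ε⇒x≈y _ _ e))
      split : y (suc i) ≈ y 0 + ε
      split = sym (trans (x∙yz≈y∙xz (y 0) (y (suc i)) (- y 0)) (trans (+-congˡ (-‿inverseʳ (y 0))) (+-identityʳ _)))

-- Agreement of series at infinity, and cancellation in compositions.

module Agreement {c ℓ : Level} (K : Field c ℓ) where
  open Field K
  open FieldProperties K
  open Exp commutativeSemiring using (_^_)
  module ^ₚ = Exp P.commutativeSemiring
  open RingProperties ring using (x≈y⇒x∙y⁻¹≈ε)

  -- A crude bound that starts the induction of `∘ₚ-kernel`; the exact degree would require deciding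
  -- whether coefficients vanish.
  drop-length : ∀ p → Drop (length p) 0 p
  drop-length []      = drop-[]
  drop-length (a ∷ p) .vanish (suc i) lt = vanish (drop-length p) i (ℕ.s<s⁻¹ lt)

  -- The coefficient of `p ∘ₚ q` at n d is that of `p` at n times β ^ n, so the latter vanishes too
  -- and the degree bound on `p` can be lowered until nothing is left.
  ∘ₚ-kernel : ∀ n {p q d β} → 0 < d → Lead d q β → ¬ β ≈ 0# →
    Drop n 0 p → (p ∘ₚ q) ≋ [] → p ≋ []
  ∘ₚ-kernel n {p} {q} {d} {β} 0<d L β≉0 D e = go n D top≈0
    where
    top≈0 : coeff p n ≈ 0#
    top≈0 = *-cancelʳ (^-≉0 n β≉0)
      (trans (sym (top (lead-∘ 0<d (mkLead D refl) L))) (trans (at e (n ℕ.* d)) (sym (zeroˡ _))))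
    go : ∀ n → Drop n 0 p → coeff p n ≈ 0# → p ≋ []
    go zero D z .at zero    = z
    go zero D z .at (suc i) = vanish D (suc i) z<s
    go (suc n) D z = ∘ₚ-kernel n 0<d L β≉0 D′ e
      where
      D′ : Drop n 0 p
      D′ .vanish i lt with ℕ.m≤n⇒m<n∨m≡n lt
      ... | inj₁ lt′ = vanish D i lt′
      ... | inj₂ eq  = trans (reflexive (≡.cong (coeff p) (≡.sym (≡.trans eq (ℕ.+-identityʳ i))))) z

  +-negₚ-cancel : ∀ p q → p ≋ (q +ₚ (p +ₚ negₚ q))
  +-negₚ-cancel p q = ≋-sym (≋-trans (x∙yz≈y∙xz q p (negₚ q))
    (≋-trans (P.+-congˡ {p} (P.-‿inverseʳ q)) (P.+-identityʳ p)))
    where open CommSemigroup P.+-commutativeSemigroup using (x∙yz≈y∙xz)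

  -- Composition is additive in its left argument, so the difference of `p` and `p′` lies in the
  -- kernel.
  ∘ₚ-cancelʳ : ∀ {p p′ q d β} → 0 < d → Lead d q β → ¬ β ≈ 0# → (p ∘ₚ q) ≋ (p′ ∘ₚ q) → p ≋ p′
  ∘ₚ-cancelʳ {p} {p′} {q} 0<d L β≉0 e =
    ≋-trans (+-negₚ-cancel p p′) (≋-trans (P.+-congˡ {p′} ε≋0) (P.+-identityʳ p′))
    where
    open RingProperties P.ring using (+-identityʳ-unique)
    ε = p +ₚ negₚ p′
    ε∘q≋0 : (ε ∘ₚ q) ≋ []
    ε∘q≋0 = +-identityʳ-unique (p′ ∘ₚ q) (ε ∘ₚ q)
      (≋-trans (≋-sym (∘ₚ-+ p′ ε q)) (≋-trans (∘ₚ-cong (≋-sym (+-negₚ-cancel p p′)) ≋-refl) e))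
    ε≋0 : ε ≋ []
    ε≋0 = ∘ₚ-kernel (length ε) 0<d L β≉0 (drop-length ε) ε∘q≋0

  lead-0⇒drop-1 : ∀ {m p} → Lead m p 0# → Drop m 1 p
  lead-0⇒drop-1 {m} {p} L .vanish i lt with ℕ.m≤n⇒m<n∨m≡n (ℕ.s≤s⁻¹ (≡.subst (m <_) (ℕ.+-comm i 1) lt))
  ... | inj₁ m<i    = vanish (low L) i (≡.subst (m <_) (≡.sym (ℕ.+-identityʳ i)) m<i)
  ... | inj₂ ≡.refl = top L

  drop-const-* : ∀ c {m k p} → Drop m k p → Drop m k (const c *ₚ p)
  drop-const-* c {p = p} D = drop-* (const c) p (drop-const c) D

  -- For p and q of degrees m and n: the m-th root of p and the n-th root of q, as series
  -- at infinity, agree up to a constant factor to relative order k.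
  record Agree (k m : ℕ) (p : Pol) (n : ℕ) (q : Pol) : Set (c ⊔ ℓ) where
    field
      s t    : ℕ
      s-tame : Tame s
      t-tame : Tame t
      degree : s ℕ.* m ≡ t ℕ.* n
      factor : Carrier
      error  : Pol
      split  : (p ^ₚ s) ≋ ((const factor *ₚ (q ^ₚ t)) +ₚ error)
      small  : Drop (s ℕ.* m) k error

  agree-mono : ∀ {k k′ m p n q} → k′ ≤ k → Agree k m p n q → Agree k′ m p n q
  agree-mono k′≤k A = record { Agree A ; small = drop-mono k′≤k (Agree.small A) }

  agree-cong : ∀ {k m p p′ n q q′} → p ≋ p′ → q ≋ q′ → Agree k m p n q → Agree k m p′ n q′
  agree-cong {p = p} {p′} {q = q} {q′} e e′ A = record
    { Agree A
    ; split = ≋-trans (^ₚ.^-congˡ s (≋-sym e))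
        (≋-trans split (P.+-congʳ {error} (P.*-congˡ {const factor} (^ₚ.^-congˡ t e′)))) }
    where open Agree A

  -- The powers `p ^ₚ n` and `q ^ₚ m` have the same degree bound n m, and the constant `x` matches
  -- their top coefficients, so their difference loses one degree. This starts the induction in
  -- `long-words-agree`.
  agree-1 : ∀ {m p α n q β} → Tame m → Tame n → Lead m p α → Lead n q β → ¬ β ≈ 0# → Agree 1 m p n q
  agree-1 {m} {p} {α} {n} {q} {β} m-tame n-tame Lp Lq β≉0 with inverse (β ^ m) (^-≉0 m β≉0)
  ... | w , βw≈1 = record
    { s = n ; t = m ; s-tame = n-tame ; t-tame = m-tame ; degree = ℕ.*-comm n m
    ; factor = x ; error = (p ^ₚ n) +ₚ negₚ r ; split = +-negₚ-cancel (p ^ₚ n) r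
    ; small = lead-0⇒drop-1 (mkLead (drop-+ {p = p ^ₚ n} (low Lpn) (drop-neg (low Lr))) top≈0) }
    where
    x = α ^ n * w
    r = const x *ₚ (q ^ₚ m)
    Lpn = lead-^ n Lp
    Lr : Lead (n ℕ.* m) r (x * β ^ m)
    Lr = ≡.subst (λ j → Lead j r (x * β ^ m)) (ℕ.*-comm m n) (lead-* (lead-const x) (lead-^ m Lq))
    xβ≈α : x * β ^ m ≈ α ^ n
    xβ≈α = trans (*-assoc _ _ _) (trans (*-congˡ (trans (*-comm _ _) βw≈1)) (*-identityʳ _))
    top≈0 : coeff ((p ^ₚ n) +ₚ negₚ r) (n ℕ.* m) ≈ 0#
    top≈0 = trans (coeff-+ (p ^ₚ n) (negₚ r) (n ℕ.* m)) (trans (+-congˡ (coeff-neg r (n ℕ.* m)))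
      (x≈y⇒x∙y⁻¹≈ε (trans (top Lpn) (sym (trans (top Lr) xβ≈α)))))

  -- Composition with `r` on the right respects sums, products, powers and constants, so the
  -- exponents and the factor stay the same and only the error changes, by `drop-∘`.
  agree-∘ : ∀ {k m p n q d r} → Drop d 0 r → Agree k m p n q →
    Agree (k ℕ.* d) (m ℕ.* d) (p ∘ₚ r) (n ℕ.* d) (q ∘ₚ r)
  agree-∘ {k} {m} {p} {n} {q} {d} {r} D A = record
    { s = s ; t = t ; s-tame = s-tame ; t-tame = t-tame
    ; degree = ≡.trans (≡.sym (ℕ.*-assoc s m d)) (≡.trans (≡.cong (ℕ._* d) degree) (ℕ.*-assoc t n d))
    ; factor = factor
    ; error = error ∘ₚ r
    ; split = begin
        (p ∘ₚ r) ^ₚ s                                            ≈⟨ ∘ₚ-^ p r s ⟨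
        (p ^ₚ s) ∘ₚ r                                            ≈⟨ ∘ₚ-cong split ≋-refl ⟩
        ((const factor *ₚ (q ^ₚ t)) +ₚ error) ∘ₚ r               ≈⟨ ∘ₚ-+ (const factor *ₚ (q ^ₚ t)) error r ⟩
        ((const factor *ₚ (q ^ₚ t)) ∘ₚ r) +ₚ (error ∘ₚ r)        ≈⟨ P.+-congʳ {error ∘ₚ r} (∘ₚ-* (const factor) (q ^ₚ t) r) ⟩
        ((const factor ∘ₚ r) *ₚ ((q ^ₚ t) ∘ₚ r)) +ₚ (error ∘ₚ r)
          ≈⟨ P.+-congʳ {error ∘ₚ r} (P.*-cong (∘ₚ-const factor r) (∘ₚ-^ q r t)) ⟩
        (const factor *ₚ ((q ∘ₚ r) ^ₚ t)) +ₚ (error ∘ₚ r)        ∎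
    ; small = ≡.subst (λ j → Drop j (k ℕ.* d) (error ∘ₚ r)) (ℕ.*-assoc s m d) (drop-∘ error r small D) }
    where
    open Agree A
    open SetoidReasoning P.setoid

  -- Apart from the power of c y, every term of the expansion contains some ε, and its other factors
  -- have degree at most m; so the relative order `k` survives.
  pow-split : ∀ {m k x y c ε} → Drop m 0 y → x ≋ ((const c *ₚ y) +ₚ ε) → Drop m k ε →
    ∀ s → ∃ λ ε′ → (x ^ₚ s) ≋ ((const (c ^ s) *ₚ (y ^ₚ s)) +ₚ ε′) × Drop (s ℕ.* m) k ε′
  pow-split Dy e Dε zero = [] , ≋-sym (≋-trans (P.+-identityʳ _) (P.*-identityˡ _)) , drop-[]
  pow-split {m} {k} {x} {y} {c} {ε} Dy e Dε (suc s) with pow-split Dy e Dε s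
  ... | ε′ , e′ , Dε′ =
    (cy *ₚ ε′) +ₚ (ε *ₚ (z +ₚ ε′)) ,
    (begin
      x *ₚ (x ^ₚ s)                                      ≈⟨ P.*-cong e e′ ⟩
      (cy +ₚ ε) *ₚ (z +ₚ ε′)
        ≈⟨ solve 6 (λ C y ε C′ Y ε′ → (C :* y :+ ε) :* (C′ :* Y :+ ε′)
                        := (C :* C′) :* (y :* Y) :+ (C :* y :* ε′ :+ ε :* (C′ :* Y :+ ε′)))
             ≋-refl (const c) y ε (const (c ^ s)) (y ^ₚ s) ε′ ⟩
      ((const c *ₚ const (c ^ s)) *ₚ (y ^ₚ suc s)) +ₚ E    ≈⟨ P.+-congʳ {E} (P.*-congʳ {y ^ₚ suc s} (const-* c (c ^ s))) ⟨
      (const (c ^ suc s) *ₚ (y ^ₚ suc s)) +ₚ E             ∎) ,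
    drop-+ {p = cy *ₚ ε′} (drop-* cy ε′ (drop-const-* c Dy) Dε′)
      (≡.subst (λ j → Drop (m ℕ.+ s ℕ.* m) j (ε *ₚ (z +ₚ ε′))) (ℕ.+-identityʳ k)
        (drop-* ε (z +ₚ ε′) Dε (drop-+ {p = z} (drop-const-* (c ^ s) Dyˢ) (drop-mono z≤n Dε′))))
    where
    open SetoidReasoning P.setoid
    open SemiringSolver P.commutativeSemiring
    cy = const c *ₚ y
    z  = const (c ^ s) *ₚ (y ^ₚ s)
    E  = (cy *ₚ ε′) +ₚ (ε *ₚ (z +ₚ ε′))
    Dyˢ : Drop (s ℕ.* m) 0 (y ^ₚ s)
    Dyˢ = low (lead-^ s (mkLead Dy refl))

  -- The two identities involve different powers of `q`. Raising the first to the power `B.s` and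
  -- the second to the power `A.t` brings both to exponent `A.t` times `B.s`; the exponents stay
  -- tame as products of tame numbers.
  agree-trans : ∀ {k m p n q o r} → Drop n 0 q → Drop o 0 r →
    Agree k m p n q → Agree k n q o r → Agree k m p o r
  agree-trans {k} {m} {p} {n} {q} {o} {r} Dq Dr A B
    with pow-split (dropPow A.t A.degree Dq) A.split A.small B.s
       | pow-split (dropPow B.t B.degree Dr) B.split B.small A.t
    where
    module A = Agree A
    module B = Agree B
    dropPow : ∀ {l n q} t → l ≡ t ℕ.* n → Drop n 0 q → Drop l 0 (q ^ₚ t)
    dropPow t ≡.refl D = low (lead-^ t (mkLead D refl))
  ... | E₁ , e₁ , D₁ | E₂ , e₂ , D₂ = record
    { s = A.s ℕ.* B.s ; t = B.t ℕ.* A.t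
    ; s-tame = tame-* {A.s} A.s-tame B.s-tame ; t-tame = tame-* {B.t} B.t-tame A.t-tame
    ; degree = deg
    ; factor = C * D
    ; error = (const C *ₚ E₂) +ₚ E₁
    ; split = begin
        p ^ₚ (A.s ℕ.* B.s)                                   ≈⟨ ^ₚ.^-assocʳ p A.s B.s ⟨
        (p ^ₚ A.s) ^ₚ B.s                                    ≈⟨ e₁ ⟩
        (const C *ₚ ((q ^ₚ A.t) ^ₚ B.s)) +ₚ E₁               ≈⟨ P.+-congʳ {E₁} (P.*-congˡ {const C} swap) ⟩
        (const C *ₚ ((q ^ₚ B.s) ^ₚ A.t)) +ₚ E₁               ≈⟨ P.+-congʳ {E₁} (P.*-congˡ {const C} e₂) ⟩
        (const C *ₚ ((const D *ₚ R) +ₚ E₂)) +ₚ E₁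
          ≈⟨ solve 5 (λ C D R E₂ E₁ → C :* (D :* R :+ E₂) :+ E₁ := (C :* D) :* R :+ (C :* E₂ :+ E₁))
               ≋-refl (const C) (const D) R E₂ E₁ ⟩
        ((const C *ₚ const D) *ₚ R) +ₚ E
          ≈⟨ P.+-congʳ {E} (P.*-cong (≋-sym (const-* C D)) (^ₚ.^-assocʳ r B.t A.t)) ⟩
        (const (C * D) *ₚ (r ^ₚ (B.t ℕ.* A.t))) +ₚ E         ∎
    ; small = drop-+ {p = const C *ₚ E₂}
        (drop-const-* C (≡.subst (λ j → Drop j k E₂) deg₂ D₂))
        (≡.subst (λ j → Drop j k E₁) deg₁ D₁) }
    where
    module A = Agree A
    module B = Agree B
    open SetoidReasoning P.setoid
    open SemiringSolver P.commutativeSemiring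
    C = A.factor ^ B.s
    D = B.factor ^ A.t
    R = (r ^ₚ B.t) ^ₚ A.t
    E = (const C *ₚ E₂) +ₚ E₁
    swap : ((q ^ₚ A.t) ^ₚ B.s) ≋ ((q ^ₚ B.s) ^ₚ A.t)
    swap = ≋-trans (^ₚ.^-assocʳ q A.t B.s)
      (≋-trans (^ₚ.^-congʳ q (ℕ.*-comm A.t B.s)) (≋-sym (^ₚ.^-assocʳ q B.s A.t)))
    rot : ∀ x y z → y ℕ.* (x ℕ.* z) ≡ x ℕ.* y ℕ.* z
    rot = solve-∀
    rot′ : ∀ x y z → x ℕ.* (y ℕ.* z) ≡ y ℕ.* (x ℕ.* z)
    rot′ = solve-∀
    deg₁ : B.s ℕ.* (A.s ℕ.* m) ≡ A.s ℕ.* B.s ℕ.* m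
    deg₁ = rot A.s B.s m
    deg₂ : A.t ℕ.* (B.s ℕ.* n) ≡ A.s ℕ.* B.s ℕ.* m
    deg₂ = ≡.trans (rot′ A.t B.s n) (≡.trans (≡.cong (B.s ℕ.*_) (≡.sym A.degree)) deg₁)
    deg : A.s ℕ.* B.s ℕ.* m ≡ B.t ℕ.* A.t ℕ.* o
    deg = ≡.trans (≡.sym deg₂) (≡.trans (≡.cong (A.t ℕ.*_) B.degree) (rot B.t A.t o))

  -- With equal degrees and leading coefficients, the exponents coincide and the factor is 1, so for
  -- H = h ^ s the error is H ∘ p - H ∘ q, that is, p - q times a difference quotient. The leading
  -- coefficient of the quotient is s n times nonzero powers, a unit by tameness. So p - q has
  -- degree at most m - k < 0.
  agree-∘-cancelˡ : ∀ {k m n p q h β δ η} → 0 < m → 0 < n → Tame n → Lead n h η → ¬ η ≈ 0# →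
    Lead m p β → Lead m q β → ¬ β ≈ 0# → m < k →
    Agree k (n ℕ.* m) (h ∘ₚ p) δ (h ∘ₚ q) → δ ≡ n ℕ.* m → p ≋ q
  agree-∘-cancelˡ {k} {m} {n} {p} {q} {h} {β} {δ} {η} 0<m 0<n n-tame Lh η≉0 Lp Lq β≉0 m<k A δ≡ =
    ≋-trans (+-negₚ-cancel p q) (≋-trans (P.+-congˡ {q} ε≋0) (P.+-identityʳ q))
    where
    open Agree A
    s≡t : s ≡ t
    s≡t = ℕ.*-cancelʳ-≡ s t (n ℕ.* m) ⦃ ℕ.>-nonZero (ℕ.*-mono-< 0<n 0<m) ⦄ (≡.trans degree (≡.cong (t ℕ.*_) δ≡))
    ε = p +ₚ negₚ q
    H = h ^ₚ s
    LH : Lead (s ℕ.* n) H (η ^ s)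
    LH = lead-^ s Lh
    LHp : Lead (s ℕ.* n ℕ.* m) (H ∘ₚ p) (η ^ s * β ^ (s ℕ.* n))
    LHp = lead-∘ 0<m LH Lp
    LHq : Lead (s ℕ.* n ℕ.* m) (H ∘ₚ q) (η ^ s * β ^ (s ℕ.* n))
    LHq = lead-∘ 0<m LH Lq
    split′ : (H ∘ₚ p) ≋ ((const factor *ₚ (H ∘ₚ q)) +ₚ error)
    split′ = ≋-trans (∘ₚ-^ h p s) (≋-trans split (P.+-congʳ {error} (P.*-congˡ {const factor}
      (≋-trans (^ₚ.^-congʳ (h ∘ₚ q) (≡.sym s≡t)) (≋-sym (∘ₚ-^ h q s))))))
    small′ : Drop (s ℕ.* n ℕ.* m) k error
    small′ = ≡.subst (λ j → Drop j k error) (≡.sym (ℕ.*-assoc s n m)) small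
    lc = η ^ s * β ^ (s ℕ.* n)
    lc≉0 : ¬ lc ≈ 0#
    lc≉0 = *-≉0 (^-≉0 s η≉0) (^-≉0 (s ℕ.* n) β≉0)
    N = s ℕ.* n ℕ.* m
    -- Both compositions have leading coefficient `lc` in degree `N`, and the error does not reach
    -- that degree because `k` is positive.
    factor≈1 : factor ≈ 1#
    factor≈1 = *-cancelʳ lc≉0 (begin
      factor * lc                                                     ≈⟨ *-congˡ (top LHq) ⟨
      factor * coeff (H ∘ₚ q) N                                       ≈⟨ top-* 0 N (const factor) (H ∘ₚ q) (drop-const factor) (low LHq) ⟨
      coeff (const factor *ₚ (H ∘ₚ q)) N                              ≈⟨ +-identityʳ _ ⟨
      coeff (const factor *ₚ (H ∘ₚ q)) N + 0#                         ≈⟨ +-congˡ (vanish small′ N (ℕ.m<m+n N (ℕ.≤-<-trans z≤n m<k))) ⟨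
      coeff (const factor *ₚ (H ∘ₚ q)) N + coeff error N              ≈⟨ coeff-+ (const factor *ₚ (H ∘ₚ q)) error N ⟨
      coeff ((const factor *ₚ (H ∘ₚ q)) +ₚ error) N                   ≈⟨ at split′ N ⟨
      coeff (H ∘ₚ p) N                                                ≈⟨ top LHp ⟩
      lc                                                              ≈⟨ *-identityˡ lc ⟨
      1# * lc                                                         ∎)
      where open SetoidReasoning setoid
    error≋ : error ≋ (ε *ₚ diffQuot H p q)
    error≋ = +-cancelˡ (H ∘ₚ q) error (ε *ₚ diffQuot H p q) (begin
      (H ∘ₚ q) +ₚ error                            ≈⟨ P.+-congʳ {error} (P.*-identityˡ (H ∘ₚ q)) ⟨
      (const 1# *ₚ (H ∘ₚ q)) +ₚ error              ≈⟨ P.+-congʳ {error} (P.*-congʳ {H ∘ₚ q} (const-cong factor≈1)) ⟨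
      (const factor *ₚ (H ∘ₚ q)) +ₚ error          ≈⟨ split′ ⟨
      H ∘ₚ p                                       ≈⟨ diffQuot-correct H (+-negₚ-cancel p q) ⟩
      (H ∘ₚ q) +ₚ (ε *ₚ diffQuot H p q)            ∎)
      where
      open SetoidReasoning P.setoid
      open RingProperties P.ring using (+-cancelˡ)
    Dε : Drop m 0 ε
    Dε = drop-+ {p = p} (low Lp) (drop-neg (low Lq))
    -- `lead-diffQuot` expects a degree of the form `suc S`; the degree s n of H is positive because
    -- it is tame.
    cancel : ∀ S → S ≡ s ℕ.* n → Drop m k ε
    cancel zero    eq = contradiction (reflexive (≡.cong _·1 (≡.sym eq))) (tame-* {s} s-tame n-tame)
    cancel (suc S) eq with inverse (suc S ·1 * (η ^ s * β ^ S))
                             (*-≉0 (≡.subst Tame (≡.sym eq) (tame-* {s} s-tame n-tame)) (*-≉0 (^-≉0 s η≉0) (^-≉0 S β≉0)))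
    ... | w , unit = drop-*-cancel ε (diffQuot H p q) Dε
      (lead-diffQuot S 0<m (≡.subst (λ j → Lead j H (η ^ s)) (≡.sym eq) LH) Lp Lq) unit
      (drop-cong error≋ (≡.subst (λ j → Drop (j ℕ.* m) k error) (≡.sym eq) small′))
    ε≋0 : ε ≋ []
    ε≋0 .at i = vanish (cancel (s ℕ.* n) ≡.refl) i (ℕ.<-≤-trans m<k (ℕ.m≤n+m k i))

-- Arithmetic of geometric sums and of exponents.

n<2^n : ∀ n → n < 2 ℕ.^ n
n<2^n zero    = z<s
n<2^n (suc n) = ℕ.+-mono-≤ (ℕ.≤-<-trans z≤n (n<2^n n)) (≡.subst (suc n ≤_) (≡.sym (ℕ.+-identityʳ (2 ℕ.^ n))) (n<2^n n))

-- The sum 1 + d + ... + d ^ (j - 1) for d = `suc e`, which is the exponent of a in the leading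
-- coefficient of f ^ j when f has degree d and leading coefficient a.
geom : ℕ → ℕ → ℕ
geom e zero    = 0
geom e (suc j) = 1 ℕ.+ suc e ℕ.* geom e j

-- Splits the geometric sum after `i` terms. The multiplier of the second part is d ^ i, written as
-- 1 + (d - 1) (1 + ... + d ^ (i - 1)).
geom-+ : ∀ e i j → geom e (i ℕ.+ j) ≡ geom e i ℕ.+ (1 ℕ.+ geom e i ℕ.* e) ℕ.* geom e j
geom-+ e zero    j = ≡.sym (ℕ.+-identityʳ (geom e j))
geom-+ e (suc i) j rewrite geom-+ e i j = identity e (geom e i) (geom e j)
  where
  identity : ∀ e x y → 1 ℕ.+ suc e ℕ.* (x ℕ.+ (1 ℕ.+ x ℕ.* e) ℕ.* y)
    ≡ (1 ℕ.+ suc e ℕ.* x) ℕ.+ (1 ℕ.+ (1 ℕ.+ suc e ℕ.* x) ℕ.* e) ℕ.* y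
  identity = solve-∀

%≡⇒∣ : ∀ n .{{_ : NonZero n}} x y → (x ℕ.+ y) % n ≡ x % n → n ∣ y
%≡⇒∣ n x y eq = ∣m+n∣m⇒∣n (divides ((x ℕ.+ y) / n) sum) (n∣m*n (x / n))
  where
  open ≡.≡-Reasoning
  sum : x / n ℕ.* n ℕ.+ y ≡ (x ℕ.+ y) / n ℕ.* n
  sum = ℕ.+-cancelˡ-≡ (x % n) _ _ (begin
    x % n ℕ.+ (x / n ℕ.* n ℕ.+ y)                    ≡⟨ ℕ.+-assoc (x % n) _ y ⟨
    x % n ℕ.+ x / n ℕ.* n ℕ.+ y                      ≡⟨ ≡.cong (ℕ._+ y) (m≡m%n+[m/n]*n x n) ⟨
    x ℕ.+ y                                          ≡⟨ m≡m%n+[m/n]*n (x ℕ.+ y) n ⟩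
    (x ℕ.+ y) % n ℕ.+ (x ℕ.+ y) / n ℕ.* n            ≡⟨ ≡.cong (ℕ._+ (x ℕ.+ y) / n ℕ.* n) eq ⟩
    x % n ℕ.+ (x ℕ.+ y) / n ℕ.* n                    ∎)

-- By pigeonhole, two of the sums for j = 0, ..., n agree modulo `n`, and their difference is d ^ i
-- times the sum of length r. The multiples of r follow by splitting off r terms at a time. The
-- factor d ^ i stays because d need not be invertible modulo `n`; it will be the degree of the
-- outermost f ^ i.
geom-periodic : ∀ e n .{{_ : NonZero n}} →
  ∃ λ i → ∃ λ r → 0 < r × (∀ k → n ∣ (1 ℕ.+ geom e i ℕ.* e) ℕ.* geom e (k ℕ.* r))
geom-periodic e n
  with pigeonhole (ℕ.n<1+n n) (λ (k : Fin (suc n)) → fromℕ< (m%n<n (geom e (toℕ k)) n))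
... | i′ , j′ , i<j , eq = i , r , ℕ.m<n⇒0<n∸m i<j , multiples
  where
  i = toℕ i′
  j = toℕ j′
  r = j ℕ.∸ i
  D = 1 ℕ.+ geom e i ℕ.* e
  eq′ : geom e i % n ≡ geom e j % n
  eq′ = ≡.trans (≡.sym (toℕ-fromℕ< _)) (≡.trans (≡.cong toℕ eq) (toℕ-fromℕ< _))
  base : n ∣ D ℕ.* geom e r
  base = %≡⇒∣ n (geom e i) (D ℕ.* geom e r)
    (≡.trans (≡.cong (_% n) (≡.trans (≡.sym (geom-+ e i r)) (≡.cong (geom e) (ℕ.m+[n∸m]≡n (ℕ.<⇒≤ i<j))))) (≡.sym eq′))
  multiples : ∀ k → n ∣ D ℕ.* geom e (k ℕ.* r)
  multiples zero    = ≡.subst (n ∣_) (≡.sym (ℕ.*-zeroʳ D)) (n ∣0)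
  multiples (suc k) = ≡.subst (n ∣_)
    (≡.trans (identity D (geom e r) (1 ℕ.+ geom e r ℕ.* e) (geom e (k ℕ.* r)))
      (≡.cong (D ℕ.*_) (≡.sym (geom-+ e r (k ℕ.* r)))))
    (∣m∣n⇒∣m+n base (∣n⇒∣m*n (1 ℕ.+ geom e r ℕ.* e) (multiples k)))
    where
    identity : ∀ D x P y → D ℕ.* x ℕ.+ P ℕ.* (D ℕ.* y) ≡ D ℕ.* (x ℕ.+ P ℕ.* y)
    identity = solve-∀

-- A word in f and g of degree D has leading coefficient a ^ A · b ^ B with A (d − 1) + B (e − 1) = D − 1,
-- and a last letter f contributes D / d to A.  As 1 / d + 1 / e ≤ 1, words of the same degree
-- ending in f and in g have different A.
exponent-gap : ∀ d e D₁ D₂ A₁ B₁ A₂ B₂ → 0 < d → 0 < e →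
  D₁ ℕ.* suc d ≡ D₂ ℕ.* suc e →
  A₁ ℕ.* d ℕ.+ B₁ ℕ.* e ℕ.+ 1 ≡ D₁ →
  A₂ ℕ.* d ℕ.+ B₂ ℕ.* e ℕ.+ 1 ≡ D₂ →
  ∃ λ n → ∃ λ k → 0 < n × D₁ ℕ.+ A₁ ≡ A₂ ℕ.+ n × D₂ ℕ.+ B₂ ≡ B₁ ℕ.+ k × n ℕ.* d ≡ k ℕ.* e
exponent-gap d e D₁ D₂ A₁ B₁ A₂ B₂ 0<d 0<e deg eq₁ eq₂ =
  n , k , ℕ.m<n⇒0<n∸m gap , A≡ , B≡ , nd≡ke
  where
  instance
    _ = ℕ.>-nonZero 0<d
    _ = ℕ.>-nonZero 0<e
  -- Here `d` and `e` are one less than the degrees. If D₁ ≤ A₂, then D₁ (1 + d) ≤ D₁ d (1 + e) ≤ A₂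
  -- d (1 + e) < D₂ (1 + e), contrary to the equality of degrees.
  gap : A₂ < D₁ ℕ.+ A₁
  gap = ℕ.≰⇒> λ le → ℕ.<-irrefl deg (begin-strict
    D₁ ℕ.* suc d                          ≡⟨ ℕ.*-suc D₁ d ⟩
    D₁ ℕ.+ D₁ ℕ.* d                       ≤⟨ ℕ.+-monoˡ-≤ _ (ℕ.≤-trans (ℕ.m≤m*n D₁ d) (ℕ.m≤m*n (D₁ ℕ.* d) e)) ⟩
    D₁ ℕ.* d ℕ.* e ℕ.+ D₁ ℕ.* d           ≡⟨ ℕ.+-comm (D₁ ℕ.* d ℕ.* e) _ ⟩
    D₁ ℕ.* d ℕ.+ D₁ ℕ.* d ℕ.* e           ≡⟨ ℕ.*-suc (D₁ ℕ.* d) e ⟨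
    D₁ ℕ.* d ℕ.* suc e                    ≤⟨ ℕ.*-monoˡ-≤ (suc e) (ℕ.*-monoˡ-≤ d (ℕ.≤-trans (ℕ.m≤m+n D₁ A₁) le)) ⟩
    A₂ ℕ.* d ℕ.* suc e                    <⟨ ℕ.*-monoˡ-< (suc e) small ⟩
    D₂ ℕ.* suc e                          ∎)
    where
    open ℕ.≤-Reasoning
    small : A₂ ℕ.* d < D₂
    small = ≡.subst (A₂ ℕ.* d <_) eq₂ (ℕ.≤-<-trans (ℕ.m≤m+n _ (B₂ ℕ.* e)) (ℕ.m<m+n _ z<s))
  n = (D₁ ℕ.+ A₁) ℕ.∸ A₂
  A≡ : D₁ ℕ.+ A₁ ≡ A₂ ℕ.+ n
  A≡ = ≡.sym (ℕ.m+[n∸m]≡n (ℕ.<⇒≤ gap))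
  -- The equality of degrees, with one copy of D₁ and of D₂ replaced by its expression in the
  -- exponents.
  balance : n ℕ.* d ℕ.+ B₁ ℕ.* e ≡ (D₂ ℕ.+ B₂) ℕ.* e
  balance = ℕ.+-cancelˡ-≡ (A₂ ℕ.* d ℕ.+ 1) _ _ (begin
    A₂ ℕ.* d ℕ.+ 1 ℕ.+ (n ℕ.* d ℕ.+ B₁ ℕ.* e)      ≡⟨ regroup A₂ n d (B₁ ℕ.* e) ⟩
    (A₂ ℕ.+ n) ℕ.* d ℕ.+ B₁ ℕ.* e ℕ.+ 1            ≡⟨ ≡.cong (λ j → j ℕ.* d ℕ.+ B₁ ℕ.* e ℕ.+ 1) A≡ ⟨
    (D₁ ℕ.+ A₁) ℕ.* d ℕ.+ B₁ ℕ.* e ℕ.+ 1           ≡⟨ regroup₁ D₁ A₁ d (B₁ ℕ.* e) ⟩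
    (A₁ ℕ.* d ℕ.+ B₁ ℕ.* e ℕ.+ 1) ℕ.+ D₁ ℕ.* d     ≡⟨ ≡.cong (ℕ._+ D₁ ℕ.* d) eq₁ ⟩
    D₁ ℕ.+ D₁ ℕ.* d                                ≡⟨ ℕ.*-suc D₁ d ⟨
    D₁ ℕ.* suc d                                   ≡⟨ deg ⟩
    D₂ ℕ.* suc e                                   ≡⟨ ℕ.*-suc D₂ e ⟩
    D₂ ℕ.+ D₂ ℕ.* e                                ≡⟨ ≡.cong (ℕ._+ D₂ ℕ.* e) eq₂ ⟨
    A₂ ℕ.* d ℕ.+ B₂ ℕ.* e ℕ.+ 1 ℕ.+ D₂ ℕ.* e       ≡⟨ regroup₂ (A₂ ℕ.* d) B₂ D₂ e ⟩
    A₂ ℕ.* d ℕ.+ 1 ℕ.+ (D₂ ℕ.+ B₂) ℕ.* e           ∎)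
    where
    open ≡.≡-Reasoning
    regroup : ∀ A n d x → A ℕ.* d ℕ.+ 1 ℕ.+ (n ℕ.* d ℕ.+ x) ≡ (A ℕ.+ n) ℕ.* d ℕ.+ x ℕ.+ 1
    regroup = solve-∀
    regroup₁ : ∀ D A d x → (D ℕ.+ A) ℕ.* d ℕ.+ x ℕ.+ 1 ≡ (A ℕ.* d ℕ.+ x ℕ.+ 1) ℕ.+ D ℕ.* d
    regroup₁ = solve-∀
    regroup₂ : ∀ x B D e → x ℕ.+ B ℕ.* e ℕ.+ 1 ℕ.+ D ℕ.* e ≡ x ℕ.+ 1 ℕ.+ (D ℕ.+ B) ℕ.* e
    regroup₂ = solve-∀
  B₁≤ : B₁ ≤ D₂ ℕ.+ B₂
  B₁≤ = ℕ.*-cancelʳ-≤ B₁ (D₂ ℕ.+ B₂) e (≡.subst (B₁ ℕ.* e ≤_) balance (ℕ.m≤n+m _ (n ℕ.* d)))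
  k = (D₂ ℕ.+ B₂) ℕ.∸ B₁
  B≡ : D₂ ℕ.+ B₂ ≡ B₁ ℕ.+ k
  B≡ = ≡.sym (ℕ.m+[n∸m]≡n B₁≤)
  nd≡ke : n ℕ.* d ≡ k ℕ.* e
  nd≡ke = ℕ.+-cancelʳ-≡ (B₁ ℕ.* e) _ _ (≡.trans balance
    (≡.trans (≡.cong (ℕ._* e) B≡) (≡.trans (ℕ.*-distribʳ-+ e B₁ k) (ℕ.+-comm (B₁ ℕ.* e) _))))

-- Words in the two letters, their degrees and leading coefficients.

module Words {c ℓ : Level} (K : Field c ℓ)
  (letterPol : Bool → Poly.Pol (Field.commutativeRing K))
  (e : Bool → ℕ) (a : Bool → Field.Carrier K)
  (0<e : ∀ b → 0 < e b)
  (letterLead : ∀ b → Degree.Lead (Field.commutativeRing K) (suc (e b)) (letterPol b) (a b))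
  (a≉0 : ∀ b → ¬ Field._≈_ K (a b) (Field.0# K))
  (letterTame : ∀ b → FieldProperties.Tame K (suc (e b)))
  where
  open Field K
  open FieldProperties K
  open Agreement K
  open Exp commutativeSemiring

  -- The head of the list is the innermost letter.
  word : List Bool → Pol
  word []      = var
  word (b ∷ w) = word w ∘ₚ letterPol b

  deg : List Bool → ℕ
  deg []      = 1
  deg (b ∷ w) = deg w ℕ.* suc (e b)

  lc : List Bool → Carrier
  lc []      = 1#
  lc (b ∷ w) = lc w * a b ^ deg w

  word-lead : ∀ w → Lead (deg w) (word w) (lc w)
  word-lead []      = mkLead (mkDrop λ { (suc (suc i)) _ → refl ; zero () ; (suc zero) (s≤s ()) }) refl
  word-lead (b ∷ w) = lead-∘ z<s (word-lead w) (letterLead b)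

  lc≉0 : ∀ w → ¬ lc w ≈ 0#
  lc≉0 []      = 1≉0
  lc≉0 (b ∷ w) = *-≉0 (lc≉0 w) (^-≉0 (deg w) (a≉0 b))

  deg-tame : ∀ w → Tame (deg w)
  deg-tame []      eq = 1≉0 (trans (sym (+-identityʳ 1#)) eq)
  deg-tame (b ∷ w) = tame-* {deg w} (deg-tame w) (letterTame b)

  0<deg : ∀ w → 0 < deg w
  0<deg []      = z<s
  0<deg (b ∷ w) = ℕ.*-mono-< {0} {deg w} {0} (0<deg w) z<s

  deg-<-∷ : ∀ b w → deg w < deg (b ∷ w)
  deg-<-∷ b w = ℕ.m<m*n (deg w) (suc (e b)) ⦃ ℕ.>-nonZero (0<deg w) ⦄ (s<s (0<e b))

  deg-++ : ∀ w h → deg (w ++ h) ≡ deg h ℕ.* deg w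
  deg-++ []      h = ≡.sym (ℕ.*-identityʳ (deg h))
  deg-++ (b ∷ w) h = ≡.trans (≡.cong (ℕ._* suc (e b)) (deg-++ w h)) (ℕ.*-assoc (deg h) (deg w) (suc (e b)))

  word-++ : ∀ w h → word (w ++ h) ≋ (word h ∘ₚ word w)
  word-++ []      h = ≋-sym (∘ₚ-identityʳ (word h))
  word-++ (b ∷ w) h = ≋-trans (∘ₚ-cong (word-++ w h) ≋-refl) (∘ₚ-assoc (word h) (word w) (letterPol b))

  lc-++ : ∀ w h → lc (w ++ h) ≈ lc h * lc w ^ deg h
  lc-++ w h = trans (sym (top (word-lead (w ++ h))))
    (trans (at (word-++ w h) (deg (w ++ h)))
      (trans (reflexive (≡.cong (coeff (word h ∘ₚ word w)) (deg-++ w h)))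
        (top (lead-∘ (0<deg w) (word-lead h) (word-lead w)))))

  word-deg : ∀ {u v} → word u ≋ word v → deg u ≡ deg v
  word-deg {u} {v} eq = lead-unique (word-lead u) (word-lead v) eq (lc≉0 u) (lc≉0 v)

  word-lc : ∀ {u v} → word u ≋ word v → lc u ≈ lc v
  word-lc {u} {v} eq = trans (sym (top (word-lead u)))
    (trans (at eq (deg u)) (trans (reflexive (≡.cong (coeff (word v)) (word-deg {u} {v} eq))) (top (word-lead v))))

  -- The exponent of `a b` in `lc w`: each letter is raised to the degree of the part of the word
  -- outside it.
  expo : Bool → List Bool → ℕ
  expo b     []          = 0
  expo true  (true  ∷ w) = deg w ℕ.+ expo true w
  expo false (false ∷ w) = deg w ℕ.+ expo false w
  expo true  (false ∷ w) = expo true w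
  expo false (true  ∷ w) = expo false w

  lc-expo : ∀ w → lc w ≈ a true ^ expo true w * a false ^ expo false w
  lc-expo []          = sym (*-identityˡ 1#)
  lc-expo (true ∷ w)  = trans (*-congʳ (lc-expo w))
    (trans (trans (*-comm _ _) (sym (*-assoc _ _ _))) (*-congʳ (sym (^-homo-* (a true) (deg w) _))))
  lc-expo (false ∷ w) = trans (*-congʳ (lc-expo w))
    (trans (*-assoc _ _ _) (*-congˡ (trans (*-comm _ _) (sym (^-homo-* (a false) (deg w) _)))))

  -- An inner letter `b` raises the degree by `deg w` times `e b`, and its exponent by `deg w`; the
  -- sum telescopes from the degree 1 of the empty word.
  deg-expo : ∀ w → expo true w ℕ.* e true ℕ.+ expo false w ℕ.* e false ℕ.+ 1 ≡ deg w
  deg-expo []          = ≡.refl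
  deg-expo (true ∷ w)  = ≡.trans (regroup (deg w) (expo true w) (e true) (expo false w ℕ.* e false))
    (≡.trans (≡.cong (ℕ._+ deg w ℕ.* e true) (deg-expo w)) (≡.sym (ℕ.*-suc (deg w) (e true))))
    where
    regroup : ∀ D A d x → (D ℕ.+ A) ℕ.* d ℕ.+ x ℕ.+ 1 ≡ (A ℕ.* d ℕ.+ x ℕ.+ 1) ℕ.+ D ℕ.* d
    regroup = solve-∀
  deg-expo (false ∷ w) = ≡.trans (regroup (deg w) (expo false w) (e false) (expo true w ℕ.* e true))
    (≡.trans (≡.cong (ℕ._+ deg w ℕ.* e false) (deg-expo w)) (≡.sym (ℕ.*-suc (deg w) (e false))))
    where
    regroup : ∀ D B d x → x ℕ.+ (D ℕ.+ B) ℕ.* d ℕ.+ 1 ≡ (x ℕ.+ B ℕ.* d ℕ.+ 1) ℕ.+ D ℕ.* d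
    regroup = solve-∀

  -- The equation u ∘ f = v ∘ g, since heads of lists are innermost.
  Relation : List Bool → List Bool → Set ℓ
  Relation u v = word (true ∷ u) ≋ word (false ∷ v)

  -- Equal innermost letters cancel on the right. A nonempty word has degree greater than 1, so it
  -- cannot equal the empty one, and two different heads must be met.
  relation-of-≢ : ∀ {u v} → u ≢ v → word u ≋ word v → ∃ λ u′ → ∃ λ v′ → Relation u′ v′
  relation-of-≢ {[]}    {[]}    u≢v eq = contradiction ≡.refl u≢v
  relation-of-≢ {[]}    {b ∷ v} u≢v eq =
    contradiction (word-deg {[]} {b ∷ v} eq) (ℕ.<⇒≢ (ℕ.≤-<-trans (0<deg v) (deg-<-∷ b v)))
  relation-of-≢ {b ∷ u} {[]}    u≢v eq =
    contradiction (≡.sym (word-deg {b ∷ u} {[]} eq)) (ℕ.<⇒≢ (ℕ.≤-<-trans (0<deg u) (deg-<-∷ b u)))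
  relation-of-≢ {true  ∷ u} {true  ∷ v} u≢v eq =
    relation-of-≢ (λ u≡v → u≢v (≡.cong (true ∷_) u≡v)) (∘ₚ-cancelʳ z<s (letterLead true) (a≉0 true) eq)
  relation-of-≢ {false ∷ u} {false ∷ v} u≢v eq =
    relation-of-≢ (λ u≡v → u≢v (≡.cong (false ∷_) u≡v)) (∘ₚ-cancelʳ z<s (letterLead false) (a≉0 false) eq)
  relation-of-≢ {true  ∷ u} {false ∷ v} u≢v eq = u , v , eq
  relation-of-≢ {false ∷ u} {true  ∷ v} u≢v eq = v , u , ≋-sym eq

  -- Let γ ^ (d - 1) = a and δ ^ (e - 1) = b in an extension, so that scaling by γ makes f monic and
  -- scaling by δ makes g monic. The condition says that γ / δ is a root of unity of order dividing
  -- (d - 1) (e - 1) n.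
  Resonant : Bool → Bool → ℕ → Set ℓ
  Resonant b b′ n = a b ^ (e b′ ℕ.* n) ≈ a b′ ^ (e b ℕ.* n)

  -- Both leading coefficients are monomials in x and y. Cancelling their common part leaves x ^ n =
  -- y ^ k with n (d - 1) = k (e - 1), and raising this to the power e - 1 gives resonance.
  relation-resonant : ∀ {u v} → Relation u v → ∃ λ n → 0 < n × Resonant true false n
  relation-resonant {u} {v} rel
    with exponent-gap (e true) (e false) (deg u) (deg v)
           (expo true u) (expo false u) (expo true v) (expo false v) (0<e true) (0<e false)
           (word-deg {true ∷ u} {false ∷ v} rel) (deg-expo u) (deg-expo v)
  ... | n , k , 0<n , A≡ , B≡ , nd≡ke = n , 0<n , (begin
    x ^ (e false ℕ.* n)    ≈⟨ ^-congʳ x (ℕ.*-comm (e false) n) ⟩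
    x ^ (n ℕ.* e false)    ≈⟨ ^-assocʳ x n (e false) ⟨
    (x ^ n) ^ e false      ≈⟨ ^-congˡ (e false) xⁿ≈yᵏ ⟩
    (y ^ k) ^ e false      ≈⟨ ^-assocʳ y k (e false) ⟩
    y ^ (k ℕ.* e false)    ≈⟨ ^-congʳ y (≡.trans (≡.sym nd≡ke) (ℕ.*-comm n (e true))) ⟩
    y ^ (e true ℕ.* n)     ∎)
    where
    open SetoidReasoning setoid
    open SemiringSolver commutativeSemiring using (solve; _:*_; _:=_)
    x = a true
    y = a false
    A₂ = expo true v
    B₁ = expo false u
    xⁿ≈yᵏ : x ^ n ≈ y ^ k
    xⁿ≈yᵏ = *-cancelʳ (*-≉0 (^-≉0 A₂ (a≉0 true)) (^-≉0 B₁ (a≉0 false))) (begin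
      x ^ n * (x ^ A₂ * y ^ B₁)     ≈⟨ solve 3 (λ p q r → p :* (q :* r) := (q :* p) :* r) refl (x ^ n) (x ^ A₂) (y ^ B₁) ⟩
      x ^ A₂ * x ^ n * y ^ B₁       ≈⟨ *-congʳ (^-homo-* x A₂ n) ⟨
      x ^ (A₂ ℕ.+ n) * y ^ B₁       ≈⟨ *-congʳ (^-congʳ x A≡) ⟨
      x ^ (deg u ℕ.+ expo true u) * y ^ B₁   ≈⟨ lc-expo (true ∷ u) ⟨
      lc (true ∷ u)                 ≈⟨ word-lc {true ∷ u} {false ∷ v} rel ⟩
      lc (false ∷ v)                ≈⟨ lc-expo (false ∷ v) ⟩
      x ^ A₂ * y ^ (deg v ℕ.+ expo false v)  ≈⟨ *-congˡ (^-congʳ y B≡) ⟩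
      x ^ A₂ * y ^ (B₁ ℕ.+ k)       ≈⟨ *-congˡ (^-homo-* y B₁ k) ⟩
      x ^ A₂ * (y ^ B₁ * y ^ k)     ≈⟨ solve 3 (λ p q r → p :* (q :* r) := r :* (p :* q)) refl (x ^ A₂) (y ^ B₁) (y ^ k) ⟩
      y ^ k * (x ^ A₂ * y ^ B₁)     ∎)

  deg-replicate : ∀ b j → deg (replicate j b) ≡ 1 ℕ.+ geom (e b) j ℕ.* e b
  deg-replicate b zero    = ≡.refl
  deg-replicate b (suc j) rewrite deg-replicate b j = identity (e b) (geom (e b) j)
    where
    identity : ∀ e x → (1 ℕ.+ x ℕ.* e) ℕ.* suc e ≡ 1 ℕ.+ (1 ℕ.+ suc e ℕ.* x) ℕ.* e
    identity = solve-∀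

  lc-replicate : ∀ b j → lc (replicate j b) ≈ a b ^ geom (e b) j
  lc-replicate b zero    = refl
  lc-replicate b (suc j) = trans (*-cong (lc-replicate b j) (^-congʳ (a b) (deg-replicate b j)))
    (trans (sym (^-homo-* (a b) (geom (e b) j) _)) (^-congʳ (a b) (identity (e b) (geom (e b) j))))
    where
    identity : ∀ e x → x ℕ.+ (1 ℕ.+ x ℕ.* e) ≡ 1 ℕ.+ suc e ℕ.* x
    identity = solve-∀

  -- Agreement of long words, and exchange of iterates.

  WordAgree : ℕ → List Bool → List Bool → Set (c ⊔ ℓ)
  WordAgree k w w′ = Agree k (deg w) (word w) (deg w′) (word w′)

  -- The appended letters are outermost, so a relation between innermost letters is preserved.
  pad : ℕ → List Bool → List Bool
  pad N w = w ++ replicate N true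

  N≤pad : ∀ N w → N ≤ length (pad N w)
  N≤pad N w = ≡.subst (N ≤_) (≡.sym (≡.trans (length-++ w) (≡.cong (length w ℕ.+_) (length-replicate N))))
    (ℕ.m≤n+m N (length w))

  -- The common innermost letter has degree at least 2, so composing with it at least doubles the
  -- order.
  agree-∷ : ∀ {k} b w w′ → WordAgree k w w′ → WordAgree (2 ℕ.* k) (b ∷ w) (b ∷ w′)
  agree-∷ {k} b w w′ A = agree-mono
    (≡.subst (_≤ k ℕ.* suc (e b)) (ℕ.*-comm k 2) (ℕ.*-monoʳ-≤ k (s≤s (0<e b))))
    (agree-∘ (low (letterLead b)) A)

  agree-via : ∀ {k b b′ w₁ w₂ w₁′ w₂′} → word (b ∷ w₁) ≋ word (b′ ∷ w₂) →
    WordAgree k (b ∷ w₁′) (b ∷ w₁) → WordAgree k (b′ ∷ w₂) (b′ ∷ w₂′) → WordAgree k (b ∷ w₁′) (b′ ∷ w₂′)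
  agree-via {k} {b} {b′} {w₁} {w₂} {w₁′} {w₂′} eq A B =
    agree-trans (low (word-lead (b′ ∷ w₂))) (low (word-lead (b′ ∷ w₂′)))
      (≡.subst (λ n → Agree k (deg (b ∷ w₁′)) (word (b ∷ w₁′)) n (word (b′ ∷ w₂)))
        (word-deg {b ∷ w₁} {b′ ∷ w₂} eq) (agree-cong ≋-refl eq A))
      B

  module _ {u v : List Bool} (rel : Relation u v) where

    pad-relation : ∀ N → Relation (pad N u) (pad N v)
    pad-relation N = ≋-trans (word-++ (true ∷ u) (replicate N true))
      (≋-trans (∘ₚ-cong {word (replicate N true)} ≋-refl rel) (≋-sym (word-++ (false ∷ v) (replicate N true))))

    -- Words with different last letters are compared through the two sides of the relation,
    -- padded on the left to be long.
    long-words-agree : ∀ N w w′ → N ≤ length w → N ≤ length w′ → WordAgree (2 ℕ.^ N) w w′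
    long-words-agree zero w w′ _ _ =
      agree-1 (deg-tame w) (deg-tame w′) (word-lead w) (word-lead w′) (lc≉0 w′)
    long-words-agree (suc N) (true  ∷ w) (true  ∷ w′) (s≤s l) (s≤s l′) =
      agree-∷ true w w′ (long-words-agree N w w′ l l′)
    long-words-agree (suc N) (false ∷ w) (false ∷ w′) (s≤s l) (s≤s l′) =
      agree-∷ false w w′ (long-words-agree N w w′ l l′)
    long-words-agree (suc N) (true ∷ w) (false ∷ w′) (s≤s l) (s≤s l′) =
      agree-via {w₁ = pad N u} {w₂ = pad N v} {w} {w′} (pad-relation N)
        (agree-∷ true w (pad N u) (long-words-agree N w (pad N u) l (N≤pad N u)))
        (agree-∷ false (pad N v) w′ (long-words-agree N (pad N v) w′ (N≤pad N v) l′))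
    long-words-agree (suc N) (false ∷ w) (true ∷ w′) (s≤s l) (s≤s l′) =
      agree-via {w₁ = pad N v} {w₂ = pad N u} {w} {w′} (≋-sym (pad-relation N))
        (agree-∷ false w (pad N v) (long-words-agree N w (pad N v) l (N≤pad N v)))
        (agree-∷ true (pad N u) w′ (long-words-agree N (pad N u) w′ (N≤pad N u) l′))

    -- For h = f ^ N the words h ∘ w and h ∘ w′ have length at least N, so they agree to order 2 ^
    -- N. With N = `deg w` this exceeds `deg w`, and h can be cancelled.
    word-determined : ∀ w w′ → deg w ≡ deg w′ → lc w ≈ lc w′ → word w ≋ word w′
    word-determined w w′ deg≡ lc≈ =
      agree-∘-cancelˡ (0<deg w) (0<deg h) (deg-tame h) (word-lead h) (lc≉0 h) (word-lead w)
        (≡.subst (λ n → Lead n (word w′) (lc w)) (≡.sym deg≡) (mkLead (low (word-lead w′)) (trans (top (word-lead w′)) (sym lc≈))))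
        (lc≉0 w) (n<2^n (deg w))
        (≡.subst (λ n → Agree (2 ℕ.^ N) n (word h ∘ₚ word w) (deg (pad N w′)) (word h ∘ₚ word w′)) (deg-++ w h)
          (agree-cong (word-++ w h) (word-++ w′ h)
            (long-words-agree N (pad N w) (pad N w′) (N≤pad N w) (N≤pad N w′))))
        (≡.trans (deg-++ w′ h) (≡.cong (deg h ℕ.*_) (≡.sym deg≡)))
      where
      N = deg w
      h = replicate N true

    -- In function notation, f ^ i ∘ g ^ m ∘ f ^ j = f ^ (i + j) ∘ g ^ m, with f and g for the
    -- letters `b` and `b′`. The degrees agree, so only the leading coefficients have to be
    -- compared.
    word-exchange : ∀ b b′ n i j m → Resonant b b′ n → n ∣ deg (replicate i b) ℕ.* geom (e b) j →
      word (replicate j b ++ (replicate m b′ ++ replicate i b)) ≋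
      word (replicate m b′ ++ (replicate j b ++ replicate i b))
    word-exchange b b′ n i j m res (divides q eq) =
      word-determined (J ++ (M ++ I)) (M ++ (J ++ I)) deg≡ lc≈
      where
      open SetoidReasoning setoid
      open SemiringSolver commutativeSemiring using (solve; _:*_; _:=_)
      J = replicate j b
      M = replicate m b′
      I = replicate i b
      Gj = geom (e b) j
      Gm = geom (e b′) m
      rot : ∀ x y z → x ℕ.* y ℕ.* z ≡ x ℕ.* z ℕ.* y
      rot = solve-∀
      deg≡ : deg (J ++ (M ++ I)) ≡ deg (M ++ (J ++ I))
      deg≡ rewrite deg-++ J (M ++ I) | deg-++ M I | deg-++ M (J ++ I) | deg-++ J I = rot (deg I) (deg M) (deg J)
      expand : ∀ w w′ → lc (w ++ (w′ ++ I)) ≈ lc I * lc w′ ^ deg I * lc w ^ (deg I ℕ.* deg w′)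
      expand w w′ = trans (lc-++ w (w′ ++ I)) (*-cong (lc-++ w′ I) (^-congʳ (lc w) (deg-++ w′ I)))
      pull : ∀ x y → x ^ (deg I ℕ.* suc y) ≈ x ^ deg I * x ^ (deg I ℕ.* y)
      pull x y = trans (^-congʳ x (ℕ.*-suc (deg I) y)) (^-homo-* x (deg I) (deg I ℕ.* y))
      exps : ∀ D x y z q n → D ℕ.* x ≡ q ℕ.* n → x ℕ.* (D ℕ.* (y ℕ.* z)) ≡ z ℕ.* n ℕ.* (q ℕ.* y)
      exps D x y z q n eq = ≡.trans (l D x y z) (≡.trans (≡.cong (ℕ._* (y ℕ.* z)) eq) (r q n y z))
        where
        l : ∀ D x y z → x ℕ.* (D ℕ.* (y ℕ.* z)) ≡ D ℕ.* x ℕ.* (y ℕ.* z)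
        l = solve-∀
        r : ∀ q n y z → q ℕ.* n ℕ.* (y ℕ.* z) ≡ z ℕ.* n ℕ.* (q ℕ.* y)
        r = solve-∀
      exps′ : ∀ D x y z q n → D ℕ.* x ≡ q ℕ.* n → y ℕ.* (D ℕ.* (x ℕ.* z)) ≡ z ℕ.* n ℕ.* (q ℕ.* y)
      exps′ D x y z q n eq = ≡.trans (l D x y z) (exps D x y z q n eq)
        where
        l : ∀ D x y z → y ℕ.* (D ℕ.* (x ℕ.* z)) ≡ x ℕ.* (D ℕ.* (y ℕ.* z))
        l = solve-∀
      -- Writing deg M = 1 + Gm (e b′) and deg J = 1 + Gj (e b) leaves these powers to be matched.
      -- Since deg I times Gj equals q n, both are the power q Gm of the two sides of the resonance.
      core : lc J ^ (deg I ℕ.* (Gm ℕ.* e b′)) ≈ lc M ^ (deg I ℕ.* (Gj ℕ.* e b))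
      core = begin
        lc J ^ (deg I ℕ.* (Gm ℕ.* e b′))               ≈⟨ ^-congˡ (deg I ℕ.* (Gm ℕ.* e b′)) (lc-replicate b j) ⟩
        (a b ^ Gj) ^ (deg I ℕ.* (Gm ℕ.* e b′))         ≈⟨ ^-assocʳ (a b) Gj _ ⟩
        a b ^ (Gj ℕ.* (deg I ℕ.* (Gm ℕ.* e b′)))       ≈⟨ ^-congʳ (a b) (exps (deg I) Gj Gm (e b′) q n eq) ⟩
        a b ^ (e b′ ℕ.* n ℕ.* (q ℕ.* Gm))              ≈⟨ ^-assocʳ (a b) (e b′ ℕ.* n) (q ℕ.* Gm) ⟨
        (a b ^ (e b′ ℕ.* n)) ^ (q ℕ.* Gm)              ≈⟨ ^-congˡ (q ℕ.* Gm) res ⟩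
        (a b′ ^ (e b ℕ.* n)) ^ (q ℕ.* Gm)              ≈⟨ ^-assocʳ (a b′) (e b ℕ.* n) (q ℕ.* Gm) ⟩
        a b′ ^ (e b ℕ.* n ℕ.* (q ℕ.* Gm))              ≈⟨ ^-congʳ (a b′) (exps′ (deg I) Gj Gm (e b) q n eq) ⟨
        a b′ ^ (Gm ℕ.* (deg I ℕ.* (Gj ℕ.* e b)))       ≈⟨ ^-assocʳ (a b′) Gm _ ⟨
        (a b′ ^ Gm) ^ (deg I ℕ.* (Gj ℕ.* e b))         ≈⟨ ^-congˡ (deg I ℕ.* (Gj ℕ.* e b)) (lc-replicate b′ m) ⟨
        lc M ^ (deg I ℕ.* (Gj ℕ.* e b))                ∎
      lc≈ : lc (J ++ (M ++ I)) ≈ lc (M ++ (J ++ I))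
      lc≈ = begin
        lc (J ++ (M ++ I))
          ≈⟨ expand J M ⟩
        lc I * lc M ^ deg I * lc J ^ (deg I ℕ.* deg M)
          ≈⟨ *-congˡ (trans (^-congʳ (lc J) (≡.cong (deg I ℕ.*_) (deg-replicate b′ m))) (pull (lc J) (Gm ℕ.* e b′))) ⟩
        lc I * lc M ^ deg I * (lc J ^ deg I * lc J ^ (deg I ℕ.* (Gm ℕ.* e b′)))
          ≈⟨ *-congˡ (*-congˡ core) ⟩
        lc I * lc M ^ deg I * (lc J ^ deg I * lc M ^ (deg I ℕ.* (Gj ℕ.* e b)))
          ≈⟨ solve 4 (λ i m j x → i :* m :* (j :* x) := i :* j :* (m :* x)) refl
               (lc I) (lc M ^ deg I) (lc J ^ deg I) (lc M ^ (deg I ℕ.* (Gj ℕ.* e b))) ⟩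
        lc I * lc J ^ deg I * (lc M ^ deg I * lc M ^ (deg I ℕ.* (Gj ℕ.* e b)))
          ≈⟨ *-congˡ (trans (^-congʳ (lc M) (≡.cong (deg I ℕ.*_) (deg-replicate b j))) (pull (lc M) (Gj ℕ.* e b))) ⟨
        lc I * lc J ^ deg I * lc M ^ (deg I ℕ.* deg J)
          ≈⟨ expand M J ⟨
        lc (M ++ (J ++ I)) ∎

-- Evaluation at points of an extension field.

module BaseChange {c ℓ : Level} (K : Field c ℓ) (E : Extension K) where
  open Extension E
  private
    module K = Field K
    module PL = Poly (Field.commutativeRing L)
    module DL = Degree (Field.commutativeRing L)
  open Field L
  open FieldProperties K
  open RingMorphisms.IsRingHomomorphism isHom
  open Horner K.commutativeRing commutativeRing ι isHom
  open SetoidReasoning setoid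

  evalAt : Carrier → Pol → Carrier
  evalAt x p = PL.eval (map ι p) x

  evalAt≡horner : ∀ x p → evalAt x p ≡ horner p x
  evalAt≡horner x []      = ≡.refl
  evalAt≡horner x (a ∷ p) = ≡.cong (λ y → ι a + x * y) (evalAt≡horner x p)

  evalAt-cong : ∀ {x y p q} → x ≈ y → p ≋ q → evalAt x p ≈ evalAt y q
  evalAt-cong {x} {y} {p} {q} x≈y e rewrite evalAt≡horner x p | evalAt≡horner y q = horner-cong e x≈y

  evalAt-+ : ∀ x p q → evalAt x (p +ₚ q) ≈ evalAt x p + evalAt x q
  evalAt-+ x p q rewrite evalAt≡horner x (p +ₚ q) | evalAt≡horner x p | evalAt≡horner x q = horner-+ p q x

  evalAt-* : ∀ x p q → evalAt x (p *ₚ q) ≈ evalAt x p * evalAt x q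
  evalAt-* x p q rewrite evalAt≡horner x (p *ₚ q) | evalAt≡horner x p | evalAt≡horner x q = horner-* p q x

  evalAt-neg : ∀ x p → evalAt x (negₚ p) ≈ - evalAt x p
  evalAt-neg x p rewrite evalAt≡horner x (negₚ p) | evalAt≡horner x p = horner-neg p x

  evalAt-∘ : ∀ x p q → evalAt x (p ∘ₚ q) ≈ evalAt (evalAt x q) p
  evalAt-∘ x []      q = refl
  evalAt-∘ x (a ∷ p) q = begin
    evalAt x (const a +ₚ (q *ₚ (p ∘ₚ q)))             ≈⟨ evalAt-+ x (const a) (q *ₚ (p ∘ₚ q)) ⟩
    evalAt x (const a) + evalAt x (q *ₚ (p ∘ₚ q))     ≈⟨ +-cong (trans (+-congˡ (zeroʳ x)) (+-identityʳ _)) (evalAt-* x q (p ∘ₚ q)) ⟩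
    ι a + evalAt x q * evalAt x (p ∘ₚ q)              ≈⟨ +-congˡ (*-congˡ (evalAt-∘ x p q)) ⟩
    ι a + evalAt x q * evalAt (evalAt x q) p          ∎

  evalAt-var : ∀ x → evalAt x var ≈ x
  evalAt-var x = begin
    ι K.0# + x * (ι K.1# + x * 0#)  ≈⟨ +-cong 0#-homo (*-congˡ (+-cong 1#-homo (zeroʳ x))) ⟩
    0# + x * (1# + 0#)              ≈⟨ +-identityˡ _ ⟩
    x * (1# + 0#)                   ≈⟨ *-congˡ (+-identityʳ 1#) ⟩
    x * 1#                          ≈⟨ *-identityʳ x ⟩
    x                               ∎

  coeff-map : ∀ p i → PL.coeff (map ι p) i ≈ ι (coeff p i)
  coeff-map []      i       = sym 0#-homo
  coeff-map (a ∷ p) zero    = refl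
  coeff-map (a ∷ p) (suc i) = coeff-map p i

  lead-map : ∀ {n p α} → Lead n p α → DL.Lead n (map ι p) (ι α)
  lead-map {n} {p} L = DL.mkLead
    (DL.mkDrop λ i lt → trans (coeff-map p i) (trans (⟦⟧-cong (vanish (low L) i lt)) 0#-homo))
    (trans (coeff-map p n) (⟦⟧-cong (top L)))

  ι-≉0 : ∀ {x} → ¬ x K.≈ K.0# → ¬ ι x ≈ 0#
  ι-≉0 {x} x≉0 ιx≈0 with K.inverse x x≉0
  ... | y , xy≈1 = 1≉0 (begin
    1#           ≈⟨ 1#-homo ⟨
    ι K.1#       ≈⟨ ⟦⟧-cong xy≈1 ⟨
    ι (x K.* y)  ≈⟨ *-homo x y ⟩
    ι x * ι y    ≈⟨ *-congʳ ιx≈0 ⟩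
    0# * ι y     ≈⟨ zeroˡ _ ⟩
    0#           ∎)

-- Orbits, and transfer of preperiodicity between the letters.

module Dynamics {c ℓ : Level} (K : Field c ℓ)
  (letterPol : Bool → Poly.Pol (Field.commutativeRing K))
  (e : Bool → ℕ) (a : Bool → Field.Carrier K)
  (0<e : ∀ b → 0 < e b)
  (letterLead : ∀ b → Degree.Lead (Field.commutativeRing K) (suc (e b)) (letterPol b) (a b))
  (a≉0 : ∀ b → ¬ Field._≈_ K (a b) (Field.0# K))
  (letterTame : ∀ b → FieldProperties.Tame K (suc (e b)))
  (E : Extension K)
  where
  open Extension E
  open Words K letterPol e a 0<e letterLead a≉0 letterTame
  open FieldProperties K
  open BaseChange K E
  open Field L
  private module PL = Poly (Field.commutativeRing L)
  open RingProperties ring using (x≈y⇒x∙y⁻¹≈ε)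
  open SetoidReasoning setoid

  orbit : Bool → ℕ → Carrier → Carrier
  orbit b n x = PL.iter n (PL.eval (map ι (letterPol b))) x

  orbit-step : ∀ b n x → orbit b n (evalAt x (letterPol b)) ≡ orbit b (suc n) x
  orbit-step b zero    x = ≡.refl
  orbit-step b (suc n) x = ≡.cong (λ y → evalAt y (letterPol b)) (orbit-step b n x)

  evalAt-replicate : ∀ b n x → evalAt x (word (replicate n b)) ≈ orbit b n x
  evalAt-replicate b zero    x = evalAt-var x
  evalAt-replicate b (suc n) x = trans (evalAt-∘ x (word (replicate n b)) (letterPol b))
    (trans (evalAt-replicate b n _) (reflexive (orbit-step b n x)))

  evalAt-word-++ : ∀ x b n w → evalAt x (word (replicate n b ++ w)) ≈ evalAt (orbit b n x) (word w)
  evalAt-word-++ x b n w = trans (evalAt-cong refl (word-++ (replicate n b) w))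
    (trans (evalAt-∘ x (word w) (word (replicate n b))) (evalAt-cong {p = word w} (evalAt-replicate b n x) ≋-refl))

  deg-replicate-< : ∀ b {m n} → m < n → deg (replicate m b) < deg (replicate n b)
  deg-replicate-< b {m} {suc n} (s≤s m≤n) with ℕ.m≤n⇒m<n∨m≡n m≤n
  ... | inj₁ m<n    = ℕ.<-trans (deg-replicate-< b m<n) (deg-<-∷ b (replicate n b))
  ... | inj₂ ≡.refl = deg-<-∷ b (replicate m b)

  -- If g ^ m x = g ^ n x, then the points f ^ (k r) x all lie in the finite set where
  -- f ^ i ∘ g ^ m and f ^ i ∘ g ^ n coincide.
  preperiodic-transfer : ∀ {u v} → Relation u v → ∀ {n} → 0 < n → ∀ b b′ → Resonant b b′ n →
    ∀ {x} → PL.Preperiodic (map ι (letterPol b′)) x → ¬ PL.Preperiodic (map ι (letterPol b)) x → ⊥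
  preperiodic-transfer {u} {v} rel {n} 0<n b b′ res {x} (m , m′ , m<m′ , per) ¬prep
    with geom-periodic (e b) n ⦃ ℕ.>-nonZero 0<n ⦄
  ... | i , r , 0<r , div =
    Roots.finitely-many-roots L (deg (M m′)) (lead-map leadQ) (ι-≉0 (lc≉0 (M m′))) y root distinct
    where
    M : ℕ → List Bool
    M j = replicate j b′ ++ replicate i b
    -- As m < m′, the two words have different degrees, so `Q` is nonzero with the leading
    -- coefficient of the longer word.
    Q = word (M m′) +ₚ negₚ (word (M m))
    y : ℕ → Carrier
    y k = orbit b (k ℕ.* r) x
    distinct : ∀ {k k′} → k < k′ → ¬ y k ≈ y k′
    distinct {k} {k′} k<k′ eq =
      ¬prep (k ℕ.* r , k′ ℕ.* r , ℕ.*-monoˡ-< r ⦃ ℕ.>-nonZero 0<r ⦄ k<k′ , eq)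
    deg< : deg (M m) < deg (M m′)
    deg< rewrite deg-++ (replicate m b′) (replicate i b) | deg-++ (replicate m′ b′) (replicate i b) =
      ℕ.*-monoʳ-< (deg (replicate i b)) ⦃ ℕ.>-nonZero (0<deg (replicate i b)) ⦄ (deg-replicate-< b′ m<m′)
    raise : ∀ {p k l} → k ≤ l → Drop k 0 p → Drop l 0 p
    raise k≤l D .vanish j lt = vanish D j (ℕ.≤-<-trans k≤l lt)
    leadQ : Lead (deg (M m′)) Q (lc (M m′))
    leadQ = mkLead
      (drop-+ {p = word (M m′)} (low (word-lead (M m′))) (drop-neg (raise (ℕ.<⇒≤ deg<) (low (word-lead (M m))))))
      (K.trans (coeff-+ (word (M m′)) (negₚ (word (M m))) (deg (M m′)))
        (K.trans (K.+-cong (top (word-lead (M m′)))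
          (vanish (drop-neg (low (word-lead (M m)))) (deg (M m′)) (≡.subst (deg (M m) <_) (≡.sym (ℕ.+-identityʳ _)) deg<)))
          (K.+-identityʳ _)))
      where module K = Field K
    -- After the exchange, the value depends on `l` only through the point `orbit b′ l x`, which is
    -- the same for m and m′.
    value : ∀ k l → evalAt (y k) (word (M l)) ≈ evalAt (orbit b′ l x) (word (replicate (k ℕ.* r) b ++ replicate i b))
    value k l = begin
      evalAt (y k) (word (M l))                          ≈⟨ evalAt-word-++ x b (k ℕ.* r) (M l) ⟨
      evalAt x (word (replicate (k ℕ.* r) b ++ M l))
        ≈⟨ evalAt-cong refl (word-exchange {u} {v} rel b b′ n i (k ℕ.* r) l res
             (≡.subst (λ D → n ∣ D ℕ.* geom (e b) (k ℕ.* r)) (≡.sym (deg-replicate b i)) (div k))) ⟩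
      evalAt x (word (replicate l b′ ++ (replicate (k ℕ.* r) b ++ replicate i b)))
        ≈⟨ evalAt-word-++ x b′ l _ ⟩
      evalAt (orbit b′ l x) (word (replicate (k ℕ.* r) b ++ replicate i b)) ∎
    root : ∀ k → evalAt (y k) Q ≈ 0#
    root k = begin
      evalAt (y k) Q                                            ≈⟨ evalAt-+ (y k) (word (M m′)) (negₚ (word (M m))) ⟩
      evalAt (y k) (word (M m′)) + evalAt (y k) (negₚ (word (M m)))   ≈⟨ +-congˡ (evalAt-neg (y k) (word (M m))) ⟩
      evalAt (y k) (word (M m′)) - evalAt (y k) (word (M m))
        ≈⟨ x≈y⇒x∙y⁻¹≈ε (trans (value k m′)
             (trans (evalAt-cong {p = word (replicate (k ℕ.* r) b ++ replicate i b)} (sym per) ≋-refl) (sym (value k m)))) ⟩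
      0#                                                        ∎

  -- A coincidence of words yields a relation and a resonance. As resonance is symmetric in the
  -- letters, preperiodicity passes in both directions, which refutes either alternative.
  words-distinct : ∀ {x} →
    (PL.Preperiodic (map ι (letterPol true)) x × ¬ PL.Preperiodic (map ι (letterPol false)) x)
    ⊎ (PL.Preperiodic (map ι (letterPol false)) x × ¬ PL.Preperiodic (map ι (letterPol true)) x) →
    ∀ {u v} → u ≢ v → ¬ word u ≋ word v
  words-distinct differ u≢v eq with relation-of-≢ u≢v eq
  ... | u′ , v′ , rel with relation-resonant {u′} {v′} rel
  ...   | n , 0<n , res with differ
  ...     | inj₁ (prep , ¬prep) = preperiodic-transfer {u′} {v′} rel 0<n false true (Field.sym K res) prep ¬prep
  ...     | inj₂ (prep , ¬prep) = preperiodic-transfer {u′} {v′} rel 0<n true false res prep ¬prep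

-- Freeness of the semigroup generated by f and g.

theorem1p5 : ∀ {c ℓ : Level} (K : Field c ℓ) (f g : Poly.Pol (Field.commutativeRing K)) →
    (∃ λ (d : ℕ) → Poly.HasDegree (Field.commutativeRing K) f d × 1 < d
    × ¬ (Field._≈_ K (Poly._·1 (Field.commutativeRing K) d) (Field.0# K))) →
    (∃ λ (e : ℕ) → Poly.HasDegree (Field.commutativeRing K) g e × 1 < e
    × ¬ (Field._≈_ K (Poly._·1 (Field.commutativeRing K) e) (Field.0# K))) →
    PrepDiffer K f g →
    Poly.FreeOnTwo (Field.commutativeRing K) f g
-- The degrees are `suc d` and `suc e`, so `d` and `e` are the exponents called degree minus one
-- above.
theorem1p5 K f g (suc d , (lcf , degf) , s≤s 0<d , tamef) (suc e , (lcg , degg) , s≤s 0<e , tameg)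
  (E , x , differ) u v u≢v u≈v =
  words-distinct differ
    (λ eq → u≢v (toList-injective (reverse-injective eq)))
    (≋-trans (≋-sym (wordPol≋ u)) (≋-trans (mk≋ u≈v) (wordPol≋ v)))
  where
  open Field K using (Carrier; _≈_; 0#; refl)
  open FieldProperties K
  exponent : Bool → ℕ
  exponent true  = d
  exponent false = e
  leading : Bool → Carrier
  leading true  = coeff f (suc d)
  leading false = coeff g (suc e)
  0<exponent : ∀ b → 0 < exponent b
  0<exponent true  = 0<d
  0<exponent false = 0<e
  drop : ∀ {p m} → (∀ i → m < i → coeff p i ≈ 0#) → Drop m 0 p
  drop high .vanish i lt = high i (≡.subst (_ <_) (ℕ.+-identityʳ i) lt)
  letterLead : ∀ b → Lead (suc (exponent b)) (letter f g b) (leading b)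
  letterLead true  = mkLead (drop degf) refl
  letterLead false = mkLead (drop degg) refl
  leading≉0 : ∀ b → ¬ leading b ≈ 0#
  leading≉0 true  = lcf
  leading≉0 false = lcg
  letterTame : ∀ b → Tame (suc (exponent b))
  letterTame true  = tamef
  letterTame false = tameg
  open Words K (letter f g) exponent leading 0<exponent letterLead leading≉0 letterTame
  open Dynamics K (letter f g) exponent leading 0<exponent letterLead leading≉0 letterTame E
  toList-injective : ∀ {u v : List⁺ Bool} → toList u ≡ toList v → u ≡ v
  toList-injective {b ∷ u} {.b ∷ .u} ≡.refl = ≡.refl
  -- `wordPol` reads from the outermost letter and `word` from the innermost, hence the reversal.
  -- The factor `var` left by the empty word is removed by `∘ₚ-identityˡ`.
  wordPol′≋ : ∀ b w → wordPol′ f g b w ≋ word (reverse (b ∷ w))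
  wordPol′≋ b []       = ≋-sym (∘ₚ-identityˡ (letter f g b))
  wordPol′≋ b (b′ ∷ w) = ≋-trans
    (∘ₚ-cong (≋-sym (∘ₚ-identityˡ (letter f g b))) (wordPol′≋ b′ w))
    (≋-trans (≋-sym (word-++ (reverse (b′ ∷ w)) (b ∷ [])))
      (P.reflexive (≡.cong word (≡.sym (unfold-reverse b (b′ ∷ w))))))
  wordPol≋ : ∀ w → wordPol f g w ≋ word (reverse (toList w))
  wordPol≋ (b ∷ w) = wordPol′≋ b w
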